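{- Let $\mathcal E$ be the pattern of vertices of equilateral triangles in $\mathbb R^2$. Then for every positive integer $n$, \[ S_{\mathcal E}(n) \le \left\lfloor \frac{(4n-1)(n-1)}{18} \right\rfloor . \]
   Context: Identify $\mathbb R^2$ with $\mathbb C$. $\mathcal E$ is the set of all $3$-element subsets $\{a,b,c\}\subseteq\mathbb C$ whose three pairwise distances are equal (vertex sets of equilateral triangles). For a finite $V\subseteq\mathbb C$, $S_{\mathcal E}(V)$ is the number of sets $P\in\mathcal E$ with $P\subseteq V$, and $S_{\mathcal E}(n)=\max\{S_{\mathcal E}(V): V\subseteq \mathbb C,\ |V|=n\}$, the maximum number of equilateral triangles whose vertices all lie in an $n$-point subset of the plane. -}

module Defs where

import Algebra.Properties.Group as Group
open import Data.Fin.Base as Fin using (Fin; toℕ; combine)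
open import Data.Fin.Properties
  using (toℕ-injective; combine-injective; injective⇒≤; sequence)
open import Data.Integer.Base as ℤ using ()
import Data.Integer.Properties as ℤ
open import Data.List.Base
  using (List; length; lookup; filter; allFin; cartesianProduct)
open import Data.List.Membership.Propositional using (_∈_)
open import Data.List.Membership.Propositional.Properties
  using (∈-filter⁺; ∈-filter⁻; ∈-cartesianProduct⁺; ∈-allFin; ∈-lookup)
import Data.List.Relation.Unary.All as All
open import Data.List.Relation.Unary.AllPairs using (_∷_)
open import Data.List.Relation.Unary.Unique.Propositional using (Unique)
open import Data.List.Relation.Unary.Unique.Propositional.Properties
  using (filter⁺; cartesianProduct⁺; allFin⁺)
open import Data.Nat.Base as ℕ using (ℕ; zero; suc; z≤n)
open import Data.Nat.Coprimality as Coprimality using (1-coprimeTo)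
import Data.Nat.Properties as ℕ
open import Data.Product.Base using (∃; ∃-syntax; _×_; _,_; proj₁; proj₂)
open import Data.Rational.Base as ℚ
  using (ℚ; mkℚ; 0ℚ; 1ℚ; ½; ∣_∣; Positive; positive; nonNegative; ↥_; 1/_)
import Data.Rational.Properties as ℚ
open import Data.Rational.Solver using (module +-*-Solver)
open import Effect.Monad using (RawMonad)
open import Function.Base using (_∘_)
open import Function.Bundles using (_⇔_; mk⇔)
open import Function.Definitions using (Injective)
open import Level using (0ℓ)
open import Relation.Binary.PropositionalEquality
open import Relation.Nullary.Decidable
  using (Dec; yes; no; ¬¬-excluded-middle)
open import Relation.Nullary.Negation
  using (¬_; contradiction; ¬¬-Monad; ¬¬-map)
open import Relation.Unary using (Pred; Decidable)

-- Reals are Cauchy sequences of rationals; equality of reals is the setoid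
-- relation _≈_ below, not _≡_.

Cauchy : (ℕ → ℚ) → Set
Cauchy x = ∀ ε → 0ℚ ℚ.< ε →
           ∃[ N ] (∀ m n → N ℕ.≤ m → N ℕ.≤ n → ∣ x m ℚ.- x n ∣ ℚ.≤ ε)

record ℝ : Set where
  constructor mkℝ
  field
    seq    : ℕ → ℚ
    cauchy : Cauchy seq

open ℝ public

infix 4 _≈_ _≤_

record _≈_ (x y : ℝ) : Set where
  constructor mk≈
  field
    converges : ∀ ε → 0ℚ ℚ.< ε →
                ∃[ N ] (∀ n → N ℕ.≤ n → ∣ seq x n ℚ.- seq y n ∣ ℚ.≤ ε)

record _≤_ (x y : ℝ) : Set where
  constructor mk≤
  field
    eventually : ∀ ε → 0ℚ ℚ.< ε →
                 ∃[ N ] (∀ n → N ℕ.≤ n → seq x n ℚ.≤ seq y n ℚ.+ ε)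

open _≈_ public
open _≤_ public

fromℚ : ℚ → ℝ
fromℚ p = mkℝ (λ _ → p) λ ε 0<ε → 0 , λ _ _ _ _ →
  ℚ.≤-trans (ℚ.≤-reflexive (cong ∣_∣ (ℚ.+-inverseʳ p))) (ℚ.<⇒≤ 0<ε)

0ℝ : ℝ
0ℝ = fromℚ 0ℚ

private
  half-pos : ∀ {ε} → 0ℚ ℚ.< ε → 0ℚ ℚ.< ½ ℚ.* ε
  half-pos {ε} 0<ε =
    ℚ.positive⁻¹ _ {{ℚ.pos*pos⇒pos ½ ε {{positive 0<ε}}}}

  half+half : ∀ ε → ½ ℚ.* ε ℚ.+ ½ ℚ.* ε ≡ ε
  half+half = solve 1 (λ ε → con ½ :* ε :+ con ½ :* ε := ε) refl
    where open +-*-Solver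

  +-cauchy : ∀ x y → Cauchy x → Cauchy y → Cauchy (λ n → x n ℚ.+ y n)
  +-cauchy x y cx cy ε 0<ε = N₁ ℕ.⊔ N₂ , bound
    where
    N₁ = proj₁ (cx (½ ℚ.* ε) (half-pos 0<ε))
    N₂ = proj₁ (cy (½ ℚ.* ε) (half-pos 0<ε))
    rearrange : ∀ a b c d → (a ℚ.+ b) ℚ.- (c ℚ.+ d) ≡ (a ℚ.- c) ℚ.+ (b ℚ.- d)
    rearrange = solve 4 (λ a b c d →
      (a :+ b) :- (c :+ d) := (a :- c) :+ (b :- d)) refl
      where open +-*-Solver
    bound : ∀ m n → N₁ ℕ.⊔ N₂ ℕ.≤ m → N₁ ℕ.⊔ N₂ ℕ.≤ n →
            ∣ (x m ℚ.+ y m) ℚ.- (x n ℚ.+ y n) ∣ ℚ.≤ ε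
    bound m n N≤m N≤n = begin
      ∣ (x m ℚ.+ y m) ℚ.- (x n ℚ.+ y n) ∣
        ≡⟨ cong ∣_∣ (rearrange (x m) (y m) (x n) (y n)) ⟩
      ∣ (x m ℚ.- x n) ℚ.+ (y m ℚ.- y n) ∣
        ≤⟨ ℚ.∣p+q∣≤∣p∣+∣q∣ (x m ℚ.- x n) (y m ℚ.- y n) ⟩
      ∣ x m ℚ.- x n ∣ ℚ.+ ∣ y m ℚ.- y n ∣
        ≤⟨ ℚ.+-mono-≤
             (proj₂ (cx _ (half-pos 0<ε)) m n
               (ℕ.m⊔n≤o⇒m≤o N₁ N₂ N≤m) (ℕ.m⊔n≤o⇒m≤o N₁ N₂ N≤n))
             (proj₂ (cy _ (half-pos 0<ε)) m n
               (ℕ.m⊔n≤o⇒n≤o N₁ N₂ N≤m) (ℕ.m⊔n≤o⇒n≤o N₁ N₂ N≤n)) ⟩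
      ½ ℚ.* ε ℚ.+ ½ ℚ.* ε
        ≡⟨ half+half ε ⟩
      ε ∎
      where open ℚ.≤-Reasoning

  neg-cauchy : ∀ x → Cauchy x → Cauchy (λ n → ℚ.- x n)
  neg-cauchy x cx ε 0<ε with N , b ← cx ε 0<ε = N , λ m n N≤m N≤n →
    subst (ℚ._≤ ε)
      (trans (sym (ℚ.∣-p∣≡∣p∣ (x m ℚ.- x n)))
             (cong ∣_∣ (ℚ.neg-distrib-+ (x m) (ℚ.- x n))))
      (b m n N≤m N≤n)

  bounded : ∀ x → Cauchy x →
            ∃[ M ] Positive M × ∃[ N ] (∀ n → N ℕ.≤ n → ∣ x n ∣ ℚ.≤ M)
  bounded x cx with N , b ← cx 1ℚ (ℚ.positive⁻¹ 1ℚ) =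
    ∣ x N ∣ ℚ.+ 1ℚ ,
    ℚ.nonNeg+pos⇒pos ∣ x N ∣ {{nonNegative (ℚ.0≤∣p∣ (x N))}} 1ℚ ,
    N , λ n N≤n → begin
      ∣ x n ∣                        ≡⟨ cong ∣_∣ (rearrange (x N) (x n)) ⟩
      ∣ x N ℚ.+ (x n ℚ.- x N) ∣      ≤⟨ ℚ.∣p+q∣≤∣p∣+∣q∣ (x N) (x n ℚ.- x N) ⟩
      ∣ x N ∣ ℚ.+ ∣ x n ℚ.- x N ∣    ≤⟨ ℚ.+-monoʳ-≤ ∣ x N ∣ (b n N N≤n ℕ.≤-refl) ⟩
      ∣ x N ∣ ℚ.+ 1ℚ                 ∎
    where
    open ℚ.≤-Reasoning
    rearrange : ∀ a b → b ≡ a ℚ.+ (b ℚ.- a)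
    rearrange = solve 2 (λ a b → b := a :+ (b :- a)) refl
      where open +-*-Solver

  divide : ∀ K → Positive K → ∀ ε → 0ℚ ℚ.< ε → ∃[ δ ] 0ℚ ℚ.< δ × K ℚ.* δ ≡ ε
  divide K K>0 ε 0<ε = 1/ K ℚ.* ε , 0<δ , (begin
    K ℚ.* (1/ K ℚ.* ε)  ≡⟨ ℚ.*-assoc K (1/ K) ε ⟨
    K ℚ.* 1/ K ℚ.* ε    ≡⟨ cong (ℚ._* ε) (ℚ.*-inverseʳ K) ⟩
    1ℚ ℚ.* ε            ≡⟨ ℚ.*-identityˡ ε ⟩
    ε                   ∎)
    where
    open ≡-Reasoning
    instance
      K-nonZero : ℚ.NonZero K
      K-nonZero = ℚ.pos⇒nonZero K {{K>0}}
    0<δ : 0ℚ ℚ.< 1/ K ℚ.* ε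
    0<δ = ℚ.positive⁻¹ _
      {{ℚ.pos*pos⇒pos (1/ K) {{ℚ.1/pos⇒pos K {{K>0}}}} ε {{positive 0<ε}}}}

  mul-mono : ∀ a b {M D} → Positive M → ∣ a ∣ ℚ.≤ M → ∣ b ∣ ℚ.≤ D →
             ∣ a ℚ.* b ∣ ℚ.≤ M ℚ.* D
  mul-mono a b {M} {D} M>0 a≤M b≤D = begin
    ∣ a ℚ.* b ∣      ≡⟨ ℚ.∣p*q∣≡∣p∣*∣q∣ a b ⟩
    ∣ a ∣ ℚ.* ∣ b ∣  ≤⟨ ℚ.*-monoʳ-≤-nonNeg ∣ b ∣ {{nonNegative (ℚ.0≤∣p∣ b)}} a≤M ⟩
    M ℚ.* ∣ b ∣      ≤⟨ ℚ.*-monoˡ-≤-nonNeg M {{ℚ.pos⇒nonNeg M {{M>0}}}} b≤D ⟩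
    M ℚ.* D          ∎
    where open ℚ.≤-Reasoning

  mul-diff : ∀ a b c d {M M′ δ} → Positive M → Positive M′ →
             ∣ a ∣ ℚ.≤ M → ∣ d ∣ ℚ.≤ M′ →
             ∣ b ℚ.- d ∣ ℚ.≤ δ → ∣ a ℚ.- c ∣ ℚ.≤ δ →
             ∣ a ℚ.* b ℚ.- c ℚ.* d ∣ ℚ.≤ (M ℚ.+ M′) ℚ.* δ
  mul-diff a b c d {M} {M′} {δ} M>0 M′>0 a≤M d≤M′ b-d≤δ a-c≤δ = begin
    ∣ a ℚ.* b ℚ.- c ℚ.* d ∣
      ≡⟨ cong ∣_∣ (rearrange a b c d) ⟩
    ∣ a ℚ.* (b ℚ.- d) ℚ.+ d ℚ.* (a ℚ.- c) ∣
      ≤⟨ ℚ.∣p+q∣≤∣p∣+∣q∣ (a ℚ.* (b ℚ.- d)) (d ℚ.* (a ℚ.- c)) ⟩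
    ∣ a ℚ.* (b ℚ.- d) ∣ ℚ.+ ∣ d ℚ.* (a ℚ.- c) ∣
      ≤⟨ ℚ.+-mono-≤ (mul-mono a (b ℚ.- d) M>0 a≤M b-d≤δ)
                    (mul-mono d (a ℚ.- c) M′>0 d≤M′ a-c≤δ) ⟩
    M ℚ.* δ ℚ.+ M′ ℚ.* δ
      ≡⟨ ℚ.*-distribʳ-+ δ M M′ ⟨
    (M ℚ.+ M′) ℚ.* δ ∎
    where
    open ℚ.≤-Reasoning
    rearrange : ∀ a b c d →
      a ℚ.* b ℚ.- c ℚ.* d ≡ a ℚ.* (b ℚ.- d) ℚ.+ d ℚ.* (a ℚ.- c)
    rearrange = solve 4 (λ a b c d →
      a :* b :- c :* d := a :* (b :- d) :+ d :* (a :- c)) refl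
      where open +-*-Solver

  *-cauchy : ∀ x y → Cauchy x → Cauchy y → Cauchy (λ n → x n ℚ.* y n)
  *-cauchy x y cx cy ε 0<ε = go (bounded x cx) (bounded y cy)
    where
    Close : (ℕ → ℚ) → ℚ → ℕ → Set
    Close z δ N = ∀ m n → N ℕ.≤ m → N ℕ.≤ n → ∣ z m ℚ.- z n ∣ ℚ.≤ δ

    Bound : (ℕ → ℚ) → ℚ → ℕ → Set
    Bound z M N = ∀ n → N ℕ.≤ n → ∣ z n ∣ ℚ.≤ M

    xy : ℕ → ℚ
    xy n = x n ℚ.* y n

    combine-bounds : ∀ {M M′ δ Nx Ny N₁ N₂} → Positive M → Positive M′ →
      (M ℚ.+ M′) ℚ.* δ ≡ ε → Bound x M Nx → Bound y M′ Ny →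
      Close x δ N₁ → Close y δ N₂ → Close xy ε ((Nx ℕ.⊔ Ny) ℕ.⊔ (N₁ ℕ.⊔ N₂))
    combine-bounds {Nx = Nx} {Ny} {N₁} {N₂} M>0 M′>0 Kδ≡ε bx by cx cy m n N≤m N≤n =
      subst (∣ xy m ℚ.- xy n ∣ ℚ.≤_) Kδ≡ε
        (mul-diff (x m) (y m) (x n) (y n) M>0 M′>0
          (bx m (ℕ.m⊔n≤o⇒m≤o Nx Ny (l N≤m)))
          (by n (ℕ.m⊔n≤o⇒n≤o Nx Ny (l N≤n)))
          (cy m n (ℕ.m⊔n≤o⇒n≤o N₁ N₂ (r N≤m)) (ℕ.m⊔n≤o⇒n≤o N₁ N₂ (r N≤n)))
          (cx m n (ℕ.m⊔n≤o⇒m≤o N₁ N₂ (r N≤m)) (ℕ.m⊔n≤o⇒m≤o N₁ N₂ (r N≤n))))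
      where
      l : ∀ {k} → (Nx ℕ.⊔ Ny) ℕ.⊔ (N₁ ℕ.⊔ N₂) ℕ.≤ k → Nx ℕ.⊔ Ny ℕ.≤ k
      l = ℕ.m⊔n≤o⇒m≤o (Nx ℕ.⊔ Ny) (N₁ ℕ.⊔ N₂)
      r : ∀ {k} → (Nx ℕ.⊔ Ny) ℕ.⊔ (N₁ ℕ.⊔ N₂) ℕ.≤ k → N₁ ℕ.⊔ N₂ ℕ.≤ k
      r = ℕ.m⊔n≤o⇒n≤o (Nx ℕ.⊔ Ny) (N₁ ℕ.⊔ N₂)

    go : ∃[ M ] Positive M × ∃ (Bound x M) → ∃[ M ] Positive M × ∃ (Bound y M) →
         ∃ (Close xy ε)
    go (M , M>0 , _ , bx) (M′ , M′>0 , _ , by) =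
      go′ (divide (M ℚ.+ M′) (ℚ.pos+pos⇒pos M {{M>0}} M′ {{M′>0}}) ε 0<ε)
      where
      go′ : ∃[ δ ] 0ℚ ℚ.< δ × (M ℚ.+ M′) ℚ.* δ ≡ ε → ∃ (Close xy ε)
      go′ (δ , 0<δ , Kδ≡ε) =
        let _ , closeˣ = cx δ 0<δ
            _ , closeʸ = cy δ 0<δ
        in _ , combine-bounds M>0 M′>0 Kδ≡ε bx by closeˣ closeʸ

infixl 6 _+_ _-_
infixl 7 _*_

_+_ : ℝ → ℝ → ℝ
x + y = mkℝ (λ n → seq x n ℚ.+ seq y n) (+-cauchy (seq x) (seq y) (cauchy x) (cauchy y))

-_ : ℝ → ℝ
- x = mkℝ (λ n → ℚ.- seq x n) (neg-cauchy (seq x) (cauchy x))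

_-_ : ℝ → ℝ → ℝ
x - y = x + (- y)

_*_ : ℝ → ℝ → ℝ
x * y = mkℝ (λ n → seq x n ℚ.* seq y n) (*-cauchy (seq x) (seq y) (cauchy x) (cauchy y))

ℂ : Set
ℂ = ℝ × ℝ

infix 4 _≋_

_≋_ : ℂ → ℂ → Set
(x , y) ≋ (x′ , y′) = x ≈ x′ × y ≈ y′

-- d = √((x - x′)² + (y - y′)²)
IsDistance : ℂ → ℂ → ℝ → Set
IsDistance (x , y) (x′ , y′) d =
  0ℝ ≤ d × d * d ≈ (x - x′) * (x - x′) + (y - y′) * (y - y′)

-- {a, b, c} belongs to the pattern 𝓔: three distinct points with all pairwise
-- distances equal.
Equilateral : ℂ → ℂ → ℂ → Set
Equilateral a b c =
  (¬ a ≋ b × ¬ b ≋ c × ¬ a ≋ c) ×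
  ∃[ d ] (IsDistance a b d × IsDistance b c d × IsDistance a c d)

-- An n-point subset of the plane, given by an enumeration without
-- repetition.
record PointSet (n : ℕ) : Set where
  field
    point     : Fin n → ℂ
    injective : Injective _≡_ _≋_ point

open PointSet public

Triple : ℕ → Set
Triple n = Fin n × Fin n × Fin n

-- Increasing index triples represent each 3-element subset of V exactly
-- once.
IsTriangle : ∀ {n} → PointSet n → Triple n → Set
IsTriangle V (i , j , k) =
  i Fin.< j × j Fin.< k × Equilateral (point V i) (point V j) (point V k)

-- s = S_𝓔(V), the number of sets P ∈ 𝓔 with P ⊆ V.  A relation rather than a
-- function, since equality of reals is not decidable.
IsTriangleCount : ∀ {n} → PointSet n → ℕ → Set
IsTriangleCount {n} V s =
  ∃[ ts ] Unique ts × (∀ (t : Triple n) → t ∈ ts ⇔ IsTriangle V t) ×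
          length ts ≡ s

IsMaximum : Pred ℕ 0ℓ → ℕ → Set
IsMaximum P m = P m × (∀ k → P k → k ℕ.≤ m)

-- m = S_𝓔(n), the maximum of S_𝓔(V) over all n-point sets V.
IsMaxTriangleCount : ℕ → ℕ → Set
IsMaxTriangleCount n = IsMaximum (λ s → ∃[ V ] IsTriangleCount {n} V s)

-- The relations above are inhabited up to double negation (classically:
-- S_𝓔(V) and S_𝓔(n) exist), so hypotheses of the form
-- IsMaxTriangleCount n m are not vacuous.

private
  ¬¬-all : ∀ {n} {P : Pred (Fin n) 0ℓ} → (∀ i → ¬ ¬ P i) → ¬ ¬ (∀ i → P i)
  ¬¬-all = sequence (RawMonad.rawApplicative ¬¬-Monad)

  allTriples : ∀ n → List (Triple n)
  allTriples n = cartesianProduct (allFin n) (cartesianProduct (allFin n) (allFin n))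

  code : ∀ {n} → Triple n → Fin (n ℕ.* (n ℕ.* n))
  code (i , j , k) = combine i (combine j k)

  code-injective : ∀ {n} {s t : Triple n} → code s ≡ code t → s ≡ t
  code-injective {s = i , j , k} {i′ , j′ , k′} eq
    with refl , eq′ ← combine-injective i (combine j k) i′ (combine j′ k′) eq
    with refl , refl ← combine-injective j k j′ k′ eq′ = refl

  lookup-injective : ∀ {A : Set} {xs : List A} → Unique xs →
                     Injective _≡_ _≡_ (lookup xs)
  lookup-injective (_ ∷ _) {Fin.zero}  {Fin.zero}  eq = refl
  lookup-injective (x∉xs ∷ u) {Fin.zero}  {Fin.suc j} eq =
    contradiction eq (All.lookup x∉xs (∈-lookup j))
  lookup-injective (x∉xs ∷ u) {Fin.suc i} {Fin.zero}  eq =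
    contradiction (sym eq) (All.lookup x∉xs (∈-lookup i))
  lookup-injective (x∉xs ∷ u) {Fin.suc i} {Fin.suc j} eq =
    cong Fin.suc (lookup-injective u eq)

  length-bound : ∀ {n} {ts : List (Triple n)} → Unique ts →
                 length ts ℕ.≤ n ℕ.* (n ℕ.* n)
  length-bound {ts = ts} u = injective⇒≤ {f = code ∘ lookup ts}
    (lookup-injective u ∘ code-injective)

  fromℕ : ℕ → ℚ
  fromℕ i = mkℚ (ℤ.+ i) 0 (Coprimality.sym (1-coprimeTo i))

  fromℚ-injective : ∀ {p q} → fromℚ p ≈ fromℚ q → p ≡ q
  fromℚ-injective {p} {q} p≈q with p ℚ.≟ q
  ... | yes p≡q = p≡q
  ... | no  p≢q = contradiction (ℚ.<-≤-trans r< r≥) (ℚ.<-irrefl refl)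
    where
    open Group ℚ.+-0-group using (x∙y⁻¹≈ε⇒x≈y)
    p-q≢0 : 0ℚ ≢ ∣ p ℚ.- q ∣
    p-q≢0 eq = p≢q (x∙y⁻¹≈ε⇒x≈y p q (ℚ.∣p∣≡0⇒p≡0 (p ℚ.- q) (sym eq)))
    0<∣p-q∣ : 0ℚ ℚ.< ∣ p ℚ.- q ∣
    0<∣p-q∣ = ℚ.≰⇒> λ ≤0 →
      p-q≢0 (ℚ.≤-antisym (ℚ.0≤∣p∣ (p ℚ.- q)) ≤0)
    dense = ℚ.<-dense 0<∣p-q∣
    r< = proj₂ (proj₂ dense)
    limit = converges p≈q (proj₁ dense) (proj₁ (proj₂ dense))
    r≥ = proj₂ limit (proj₁ limit) ℕ.≤-refl

  points : ∀ n → PointSet n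
  points n = record
    { point     = λ i → fromℚ (fromℕ (toℕ i)) , 0ℝ
    ; injective = λ (eq , _) →
        toℕ-injective (ℤ.+-injective (cong ↥_ (fromℚ-injective eq)))
    }

  ¬¬-maximum : ∀ {P : Pred ℕ 0ℓ} b → (∀ k → P k → k ℕ.≤ b) → ∃ P →
               ¬ ¬ ∃ (IsMaximum P)
  ¬¬-maximum zero    ub (k , Pk) ¬max with z≤n ← ub k Pk = ¬max (0 , Pk , ub)
  ¬¬-maximum {P} (suc b) ub ∃P ¬max = ¬¬-excluded-middle λ where
    (yes Pb) → ¬max (suc b , Pb , ub)
    (no ¬Pb) → ¬¬-maximum b
      (λ k Pk → ℕ.≤-pred (ℕ.≤∧≢⇒< (ub k Pk) λ { refl → ¬Pb Pk })) ∃P ¬max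

triangleCount-exists : ∀ {n} (V : PointSet n) → ¬ ¬ ∃ (IsTriangleCount V)
triangleCount-exists {n} V = ¬¬-map count
  (¬¬-all λ i → ¬¬-all λ j → ¬¬-all λ k → ¬¬-excluded-middle)
  where
  count : (∀ i j k → Dec (IsTriangle V (i , j , k))) → ∃ (IsTriangleCount V)
  count dec = _ , filter dec′ (allTriples n) ,
    filter⁺ dec′ (cartesianProduct⁺ (allFin⁺ n)
                   (cartesianProduct⁺ (allFin⁺ n) (allFin⁺ n))) ,
    (λ t → mk⇔
      (proj₂ ∘ ∈-filter⁻ dec′ {xs = allTriples n})
      (∈-filter⁺ dec′ (∈-cartesianProduct⁺ (∈-allFin _)
                        (∈-cartesianProduct⁺ (∈-allFin _) (∈-allFin _))))) ,
    refl
    where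
    dec′ : Decidable (IsTriangle V)
    dec′ (i , j , k) = dec i j k

maxTriangleCount-exists : ∀ n → ¬ ¬ ∃ (IsMaxTriangleCount n)
maxTriangleCount-exists n ¬max = triangleCount-exists (points n)
  λ (s , c) → ¬¬-maximum (n ℕ.* (n ℕ.* n))
    (λ { _ (_ , _ , u , _ , refl) → length-bound u }) (s , points n , c) ¬max

{-# OPTIONS --safe #-}

-- Let R be the rotation by 60 degrees and compare points of V by the
-- lexicographic orders of their images under R⁰, R¹ and R².  For a fixed vertex
-- z, the equilateral triangles zyx with y - z = R (x - z) form a partial matching
-- between the points y and x, in which y lies above z in one order iff x lies
-- above z in the next one (after the third comes the reverse of the first).
-- Let uₖ and dₖ count the points above and below z in the k-th order.  Since a
-- matching is no larger than a vertex cover, the number deg z of these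
-- triangles is at most u₀ + d₁, d₀ + u₁, u₁ + d₂, d₁ + u₂, u₂ + u₀ and d₂ + d₀,
-- hence at most the sum of two of the three depths lₖ = min (uₖ , dₖ).  So
-- 3 deg z ≤ Σₖ (2q + 3 max (0 , lₖ - q)) for every q ≥ 0.  In each order the
-- points have the n distinct ranks, so summing over z gives
-- 3 S ≤ Σ (2q + 3 max (0 , min (l , n - 1 - l) - q)) over 0 ≤ l < n, and q ≈ n / 6
-- yields the bound.
module Submission where

open import Data.Fin.Base as Fin using (Fin; toℕ; fromℕ; fromℕ<; inject₁)
import Data.Fin.Properties as Fin
open import Data.Product.Base using (∃-syntax; _×_; _,_; proj₁; proj₂)
import Data.Sum.Base as Sum
open import Data.Sum.Base using (_⊎_; inj₁; inj₂)
open import Effect.Monad using (RawMonad)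
open import Function.Base using (_∘_; id)
open import Function.Bundles using (Equivalence)
open import Level using (0ℓ)
open import Relation.Binary.Core using (Rel)
open import Relation.Binary.Definitions using (DecidableEquality; Trichotomous; tri<; tri≈; tri>)
open import Relation.Binary.PropositionalEquality
open import Relation.Binary.Structures using (IsStrictTotalOrder)
open import Relation.Nullary.Decidable
  using (Dec; yes; no; _×-dec_; _⊎-dec_; from-yes; decidable-stable; ¬¬-excluded-middle)
open import Relation.Nullary.Negation using (¬_; contradiction; ¬¬-Monad)

module Combinatorics where

  open import Data.Nat.Properties
  open import Algebra.Properties.CommutativeMonoid.Sum +-0-commutativeMonoid
    using (sum; sum-syntax; ∑-comm; ∑-distrib-+; sum-cong-≗; sum-init-last)
  open import Algebra.Properties.Semiring.Sum +-*-semiring using (*-distribˡ-sum)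
  open import Data.List.Base using (List; []; _∷_; length)
  open import Data.List.Membership.Propositional using (_∈_)
  import Data.List.Relation.Unary.All as All
  open import Data.List.Relation.Unary.AllPairs using ([]; _∷_)
  open import Data.List.Relation.Unary.Any using (here; there)
  open import Data.List.Relation.Unary.Unique.Propositional using (Unique)
  open import Data.Fin.Base using (zero; suc)
  open import Data.Nat hiding (compare)
  open import Data.Nat.DivMod using (m≡m%n+[m/n]*n; m%n<n; /-monoˡ-≤; m*n/n≡m)
  open import Data.Nat.Tactic.RingSolver using (solve-∀)
  open import Data.Product.Properties using (≡-dec)
  open import Defs using (Triple)

  -- Indicator sums and matchings.

  𝟙 : {P : Set} → Dec P → ℕ
  𝟙 (yes _) = 1
  𝟙 (no _)  = 0

  private variable
    m n : ℕ
    P : Set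

  𝟙≤ : ∀ {c} (P? : Dec P) → (P → 1 ≤ c) → 𝟙 P? ≤ c
  𝟙≤ (yes p) 1≤c = 1≤c p
  𝟙≤ (no _)  _   = z≤n

  1≤𝟙 : (P? : Dec P) → P → 1 ≤ 𝟙 P?
  1≤𝟙 (yes _) _ = ≤-refl
  1≤𝟙 (no ¬p) p = contradiction p ¬p

  -- Iterated, this bounds a sum of mutually exclusive indicators: `c` stands for the indicators
  -- still to come, which vanish once `P` holds.
  𝟙-disjoint : ∀ {c d} (P? : Dec P) → (P → c ≡ 0) → (P → 1 ≤ d) → c ≤ d → 𝟙 P? + c ≤ d
  𝟙-disjoint (yes p) c≡0 1≤d _ rewrite c≡0 p = 1≤d p
  𝟙-disjoint (no _)  _   _ c≤d = c≤d

  𝟙≡0 : (P? : Dec P) → ¬ P → 𝟙 P? ≡ 0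
  𝟙≡0 (yes p) ¬p = contradiction p ¬p
  𝟙≡0 (no _)  _  = refl

  ∑-mono : {f g : Fin n → ℕ} → (∀ i → f i ≤ g i) → sum f ≤ sum g
  ∑-mono {zero}  f≤g = z≤n
  ∑-mono {suc n} f≤g = +-mono-≤ (f≤g zero) (∑-mono (f≤g ∘ suc))

  term≤∑ : (f : Fin n → ℕ) (i : Fin n) → f i ≤ sum f
  term≤∑ f zero    = m≤m+n _ _
  term≤∑ f (suc i) = ≤-trans (term≤∑ (f ∘ suc) i) (m≤n+m _ (f zero))

  ∑-const : ∀ n c → ∑[ _ < n ] c ≡ n * c
  ∑-const zero    c = refl
  ∑-const (suc n) c = cong (c +_) (∑-const n c)

  ∑𝟙≤1 : {P : Fin n → Set} (P? : ∀ i → Dec (P i)) →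
         (∀ {i j} → P i → P j → i ≡ j) → ∑[ i < n ] 𝟙 (P? i) ≤ 1
  ∑𝟙≤1 {zero}  P? unique = z≤n
  ∑𝟙≤1 {suc n} P? unique = 𝟙-disjoint (P? zero)
    (λ p → n≤0⇒n≡0 (≤-trans
      (∑-mono λ i → ≤-reflexive (𝟙≡0 (P? (suc i)) λ q → contradiction (unique p q) λ ()))
      (≤-reflexive (trans (∑-const n 0) (*-zeroʳ n)))))
    (λ _ → ≤-refl)
    (∑𝟙≤1 (P? ∘ suc) λ p q → Fin.suc-injective (unique p q))

  -- Double counting of the pairs with `f i ≡ j`: each `i` finds its image among the `j`, and each
  -- `j` has at most one preimage.
  ∑-injection : (g : Fin n → ℕ) (f : Fin m → Fin n) → (∀ {i j} → f i ≡ f j → i ≡ j) →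
                ∑[ i < m ] g (f i) ≤ sum g
  ∑-injection {n} {m} g f f-injective = begin
    ∑[ i < m ] g (f i)
      ≤⟨ ∑-mono (λ i → ≤-trans
           (≤-trans (≤-reflexive (sym (*-identityʳ _)))
             (*-monoʳ-≤ (g (f i)) (1≤𝟙 (f i Fin.≟ f i) refl)))
           (term≤∑ (λ j → g j * 𝟙 (f i Fin.≟ j)) (f i))) ⟩
    ∑[ i < m ] ∑[ j < n ] (g j * 𝟙 (f i Fin.≟ j))
      ≡⟨ ∑-comm (λ i j → g j * 𝟙 (f i Fin.≟ j)) ⟩
    ∑[ j < n ] ∑[ i < m ] (g j * 𝟙 (f i Fin.≟ j))
      ≤⟨ ∑-mono (λ j → begin
           ∑[ i < m ] (g j * 𝟙 (f i Fin.≟ j))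
             ≡⟨ *-distribˡ-sum (g j) (λ i → 𝟙 (f i Fin.≟ j)) ⟨
           g j * ∑[ i < m ] 𝟙 (f i Fin.≟ j)
             ≤⟨ *-monoʳ-≤ (g j) (∑𝟙≤1 (λ i → f i Fin.≟ j) λ p q → f-injective (trans p (sym q))) ⟩
           g j * 1
             ≡⟨ *-identityʳ (g j) ⟩
           g j ∎) ⟩
    sum g ∎
    where open ≤-Reasoning

  -- The easy half of König's theorem: a matching is at most as large as any
  -- vertex cover A ⊎ B.
  matching≤cover :
    {T : Fin m → Fin n → Set} {A : Fin m → Set} {B : Fin n → Set} →
    (T? : ∀ y x → Dec (T y x)) (A? : ∀ y → Dec (A y)) (B? : ∀ x → Dec (B x)) →
    (∀ {y x x′} → T y x → T y x′ → x ≡ x′) →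
    (∀ {y y′ x} → T y x → T y′ x → y ≡ y′) →
    (∀ {y x} → T y x → A y ⊎ B x) →
    ∑[ y < m ] ∑[ x < n ] 𝟙 (T? y x) ≤ ∑[ y < m ] 𝟙 (A? y) + ∑[ x < n ] 𝟙 (B? x)
  matching≤cover {m} {n} {T} {A} {B} T? A? B? functional injective cover = begin
    ∑[ y < m ] ∑[ x < n ] 𝟙 (T? y x)
      ≤⟨ ∑-mono (λ y → ∑-mono λ x → split y x) ⟩
    ∑[ y < m ] ∑[ x < n ] (TA y x + TB y x)
      ≡⟨ sum-cong-≗ (λ y → ∑-distrib-+ (TA y) (TB y)) ⟩
    ∑[ y < m ] (∑[ x < n ] TA y x + ∑[ x < n ] TB y x)
      ≡⟨ ∑-distrib-+ (λ y → ∑[ x < n ] TA y x) (λ y → ∑[ x < n ] TB y x) ⟩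
    ∑[ y < m ] ∑[ x < n ] TA y x + ∑[ y < m ] ∑[ x < n ] TB y x
      ≡⟨ cong (∑[ y < m ] ∑[ x < n ] TA y x +_) (∑-comm TB) ⟩
    ∑[ y < m ] ∑[ x < n ] TA y x + ∑[ x < n ] ∑[ y < m ] TB y x
      -- A vertex of the cover is charged with at most one edge, since the edges form a matching; a
      -- vertex outside it is charged with none.
      ≤⟨ +-mono-≤
           (∑-mono λ y → guarded (A? y) (λ x → T? y x ×-dec A? y) proj₂
             λ (t , _) (t′ , _) → functional t t′)
           (∑-mono λ x → guarded (B? x) (λ y → T? y x ×-dec B? x) proj₂
             λ (t , _) (t′ , _) → injective t t′) ⟩
    ∑[ y < m ] 𝟙 (A? y) + ∑[ x < n ] 𝟙 (B? x) ∎
    where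
    open ≤-Reasoning
    TA TB : Fin m → Fin n → ℕ
    TA y x = 𝟙 (T? y x ×-dec A? y)
    TB y x = 𝟙 (T? y x ×-dec B? x)

    split : ∀ y x → 𝟙 (T? y x) ≤ TA y x + TB y x
    split y x = 𝟙≤ (T? y x) λ t → case t (cover t)
      where
      case : T y x → A y ⊎ B x → 1 ≤ TA y x + TB y x
      case t (inj₁ a) = m≤n⇒m≤n+o (TB y x) (1≤𝟙 (T? y x ×-dec A? y) (t , a))
      case t (inj₂ b) = m≤n⇒m≤o+n (TA y x) (1≤𝟙 (T? y x ×-dec B? x) (t , b))

    guarded : ∀ {k} {C : Set} {P : Fin k → Set} (C? : Dec C) (P? : ∀ i → Dec (P i)) →
              (∀ {i} → P i → C) → (∀ {i j} → P i → P j → i ≡ j) →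
              ∑[ i < k ] 𝟙 (P? i) ≤ 𝟙 C?
    guarded (yes _) P? _   unique = ∑𝟙≤1 P? unique
    guarded {k} (no ¬c) P? P⇒C _  = ≤-trans
      (∑-mono λ i → ≤-reflexive (𝟙≡0 (P? i) (¬c ∘ P⇒C)))
      (≤-reflexive (trans (∑-const k 0) (*-zeroʳ k)))

  -- Ranks in a strict total order.

  module Ranks {m : ℕ} {_≺_ : Rel (Fin (suc m)) 0ℓ}
               (isSTO : IsStrictTotalOrder _≡_ _≺_) where

    open IsStrictTotalOrder isSTO using (compare; irrefl; asym) renaming (_<?_ to _≺?_; trans to ≺-trans)

    above below : Fin (suc m) → ℕ
    above z = ∑[ y < suc m ] 𝟙 (z ≺? y)
    below z = ∑[ y < suc m ] 𝟙 (y ≺? z)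

    -- The point `z` itself accounts for the one by which `suc m` exceeds `m`; the three positions
    -- of `y` relative to `z` exclude one another.
    above+below≤m : ∀ z → above z + below z ≤ m
    above+below≤m z = +-cancelˡ-≤ 1 _ _ (begin
      1 + (above z + below z)
        ≤⟨ +-monoˡ-≤ (above z + below z)
             (≤-trans (1≤𝟙 (z Fin.≟ z) refl) (term≤∑ (λ y → 𝟙 (z Fin.≟ y)) z)) ⟩
      ∑[ y < suc m ] 𝟙 (z Fin.≟ y) + (above z + below z)
        ≡⟨ cong (∑[ y < suc m ] 𝟙 (z Fin.≟ y) +_)
             (∑-distrib-+ (λ y → 𝟙 (z ≺? y)) (λ y → 𝟙 (y ≺? z))) ⟨
      ∑[ y < suc m ] 𝟙 (z Fin.≟ y) + ∑[ y < suc m ] (𝟙 (z ≺? y) + 𝟙 (y ≺? z))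
        ≡⟨ ∑-distrib-+ (λ y → 𝟙 (z Fin.≟ y)) (λ y → 𝟙 (z ≺? y) + 𝟙 (y ≺? z)) ⟨
      ∑[ y < suc m ] (𝟙 (z Fin.≟ y) + (𝟙 (z ≺? y) + 𝟙 (y ≺? z)))
        ≤⟨ ∑-mono exclusive ⟩
      ∑[ _ < suc m ] 1
        ≡⟨ trans (∑-const (suc m) 1) (*-identityʳ (suc m)) ⟩
      suc m ∎)
      where
      open ≤-Reasoning
      exclusive : ∀ y → 𝟙 (z Fin.≟ y) + (𝟙 (z ≺? y) + 𝟙 (y ≺? z)) ≤ 1
      exclusive y = 𝟙-disjoint (z Fin.≟ y)
        (λ { refl → cong₂ _+_ (𝟙≡0 (z ≺? y) (irrefl refl)) (𝟙≡0 (y ≺? z) (irrefl refl)) })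
        (λ _ → ≤-refl)
        (𝟙-disjoint (z ≺? y) (λ z≺y → 𝟙≡0 (y ≺? z) (asym z≺y)) (λ _ → ≤-refl)
          (𝟙≤ (y ≺? z) λ _ → ≤-refl))

    -- Whatever lies above `z′` lies above `z` by transitivity, and `z′` itself is one point more.
    above-anti : ∀ {z z′} → z ≺ z′ → above z′ < above z
    above-anti {z} {z′} z≺z′ = begin
      1 + above z′
        ≤⟨ +-monoˡ-≤ (above z′)
             (≤-trans (1≤𝟙 (z′ Fin.≟ z′) refl) (term≤∑ (λ y → 𝟙 (z′ Fin.≟ y)) z′)) ⟩
      ∑[ y < suc m ] 𝟙 (z′ Fin.≟ y) + above z′
        ≡⟨ ∑-distrib-+ (λ y → 𝟙 (z′ Fin.≟ y)) (λ y → 𝟙 (z′ ≺? y)) ⟨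
      ∑[ y < suc m ] (𝟙 (z′ Fin.≟ y) + 𝟙 (z′ ≺? y))
        ≤⟨ ∑-mono (λ y → 𝟙-disjoint (z′ Fin.≟ y)
             (λ { refl → 𝟙≡0 (z′ ≺? y) (irrefl refl) })
             (λ { refl → 1≤𝟙 (z ≺? y) z≺z′ })
             (𝟙≤ (z′ ≺? y) λ z′≺y → 1≤𝟙 (z ≺? y) (≺-trans z≺z′ z′≺y))) ⟩
      above z ∎
      where open ≤-Reasoning

    above<suc-m : ∀ z → above z < suc m
    above<suc-m z = s≤s (m+n≤o⇒m≤o _ (above+below≤m z))

    rank : Fin (suc m) → Fin (suc m)
    rank z = fromℕ< (above<suc-m z)

    rank-injective : ∀ {z z′} → rank z ≡ rank z′ → z ≡ z′
    rank-injective {z} {z′} eq with compare z z′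
    ... | tri< z≺z′ _ _ = contradiction (above-eq eq) (>⇒≢ (above-anti z≺z′))
      where
      above-eq : rank z ≡ rank z′ → above z ≡ above z′
      above-eq = Fin.fromℕ<-injective _ _ (above<suc-m z) (above<suc-m z′)
    ... | tri≈ _ z≡z′ _ = z≡z′
    ... | tri> _ _ z′≺z = contradiction (Fin.fromℕ<-injective _ _ (above<suc-m z) (above<suc-m z′) eq)
                            (<⇒≢ (above-anti z′≺z))

    -- Ranks are distinct, so the sum over points injects into the sum over ranks; `below z` is at
    -- most what the rank leaves over from `m`.
    ∑-depth : (φ : ℕ → ℕ) → (∀ {a b} → a ≤ b → φ a ≤ φ b) →
              ∑[ z < suc m ] φ (above z ⊓ below z) ≤
              ∑[ l < suc m ] φ (toℕ l ⊓ (m ∸ toℕ l))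
    ∑-depth φ φ-mono = ≤-trans
      (∑-mono λ z → ≤-trans
        (φ-mono (⊓-monoʳ-≤ (above z) (m+n≤o⇒m≤o∸n (below z)
          (≤-trans (≤-reflexive (+-comm (below z) (above z))) (above+below≤m z)))))
        (≤-reflexive (cong (λ l → φ (l ⊓ (m ∸ l))) (sym (Fin.toℕ-fromℕ< (above<suc-m z))))))
      (∑-injection (λ l → φ (toℕ l ⊓ (m ∸ toℕ l))) rank rank-injective)

  -- Sums over depths.

  ∑-depths : ℕ → (ℕ → ℕ) → ℕ
  ∑-depths m f = ∑[ l < suc m ] f (toℕ l ⊓ (m ∸ toℕ l))

  -- The first and the last rank have depth zero, and every other depth is one more than in the
  -- chain without these two.
  ∑-depths-peel : ∀ m f → ∑-depths (2 + m) f ≡ f 0 + (∑-depths m (f ∘ suc) + f 0)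
  ∑-depths-peel m f = cong (f 0 +_) (trans
    (sum-init-last {suc m} (λ l → f (suc (toℕ l) ⊓ (suc m ∸ toℕ l))))
    (cong₂ _+_
      (sum-cong-≗ λ l → cong f (trans
        (cong (λ k → suc k ⊓ (suc m ∸ k)) (Fin.toℕ-inject₁ l))
        (cong (suc (toℕ l) ⊓_) (+-∸-assoc 1 (≤-pred (Fin.toℕ<n l))))))
      (cong f (trans
        (cong (λ k → suc k ⊓ (suc m ∸ k)) (Fin.toℕ-fromℕ (suc m)))
        (trans (cong (suc (suc m) ⊓_) (n∸n≡0 (suc m))) (⊓-zeroʳ (suc (suc m))))))))

  -- While `q` is positive, peeling off both ends lowers `m` by two and `q` by one, which changes
  -- neither side. At `q = 0` it takes one unit from each of the `suc m` inner ranks, and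
  -- `4 (m + 1)` is the difference of the squares of `m + 2` and `m`.
  ∑-depths-∸ : ∀ m q → 4 * ∑-depths m (_∸ q) ≤ (m ∸ (q + q)) * (m ∸ (q + q))
  ∑-depths-∸ 0 q rewrite 0∸n≡0 q = z≤n
  ∑-depths-∸ 1 q rewrite 0∸n≡0 q = z≤n
  ∑-depths-∸ (suc (suc m)) (suc q) = begin
    4 * ∑-depths (2 + m) (_∸ suc q)
      ≡⟨ cong (4 *_) (trans (∑-depths-peel m (_∸ suc q)) (+-identityʳ _)) ⟩
    4 * ∑-depths m (_∸ q)
      ≤⟨ ∑-depths-∸ m q ⟩
    (m ∸ (q + q)) * (m ∸ (q + q))
      ≡⟨ cong (λ k → k * k) (cong (suc m ∸_) (+-suc q q)) ⟨
    (suc m ∸ (q + suc q)) * (suc m ∸ (q + suc q)) ∎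
    where open ≤-Reasoning
  ∑-depths-∸ (suc (suc m)) zero = begin
    4 * ∑-depths (2 + m) id
      ≡⟨ cong (4 *_) (trans (∑-depths-peel m id) (+-identityʳ _)) ⟩
    4 * ∑-depths m suc
      ≡⟨ cong (4 *_) (∑-distrib-+ {suc m} (λ _ → 1) (λ l → toℕ l ⊓ (m ∸ toℕ l))) ⟩
    4 * (∑[ _ < suc m ] 1 + ∑-depths m id)
      ≡⟨ cong (λ k → 4 * (k + ∑-depths m id)) (trans (∑-const (suc m) 1) (*-identityʳ (suc m))) ⟩
    4 * (suc m + ∑-depths m id)
      ≡⟨ *-distribˡ-+ 4 (suc m) _ ⟩
    4 * suc m + 4 * ∑-depths m id
      ≤⟨ +-monoʳ-≤ (4 * suc m) (∑-depths-∸ m zero) ⟩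
    4 * suc m + m * m
      ≡⟨ square m ⟩
    (2 + m) * (2 + m) ∎
    where
    open ≤-Reasoning
    square : ∀ m → 4 * suc m + m * m ≡ (2 + m) * (2 + m)
    square = solve-∀

  -- Sums over triples.

  ∑³ : (Triple n → ℕ) → ℕ
  ∑³ {n} f = ∑[ i < n ] ∑[ j < n ] ∑[ k < n ] f (i , j , k)

  ∑³-mono : {f g : Triple n → ℕ} → (∀ t → f t ≤ g t) → ∑³ f ≤ ∑³ g
  ∑³-mono f≤g = ∑-mono λ i → ∑-mono λ j → ∑-mono λ k → f≤g (i , j , k)

  ∑³-+ : (f g : Triple n → ℕ) → ∑³ (λ t → f t + g t) ≡ ∑³ f + ∑³ g
  ∑³-+ {n} f g = trans
    (sum-cong-≗ λ i → trans
      (sum-cong-≗ λ j → ∑-distrib-+ (λ k → f (i , j , k)) (λ k → g (i , j , k)))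
      (∑-distrib-+ (λ j → ∑[ k < n ] f (i , j , k)) (λ j → ∑[ k < n ] g (i , j , k))))
    (∑-distrib-+ (λ i → ∑[ j < n ] ∑[ k < n ] f (i , j , k))
                 (λ i → ∑[ j < n ] ∑[ k < n ] g (i , j , k)))

  swap turn : Triple n → Triple n
  swap (i , j , k) = i , k , j
  turn (i , j , k) = j , k , i

  ∑³-swap : (f : Triple n → ℕ) → ∑³ (f ∘ swap) ≡ ∑³ f
  ∑³-swap {n} f = sum-cong-≗ λ i → ∑-comm (λ j k → f (i , k , j))

  ∑³-turn : (f : Triple n → ℕ) → ∑³ (f ∘ turn) ≡ ∑³ f
  ∑³-turn {n} f = trans (∑-comm λ i j → ∑[ k < n ] f (j , k , i))
    (sum-cong-≗ λ j → ∑-comm λ i k → f (j , k , i))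

  _≟³_ : DecidableEquality (Triple n)
  _≟³_ = ≡-dec Fin._≟_ (≡-dec Fin._≟_ Fin._≟_)

  term≤∑³ : (f : Triple n → ℕ) (t : Triple n) → f t ≤ ∑³ f
  term≤∑³ {n} f (i , j , k) = ≤-trans (term≤∑ (λ k → f (i , j , k)) k)
    (≤-trans (term≤∑ (λ j → ∑[ k < n ] f (i , j , k)) j)
      (term≤∑ (λ i → ∑[ j < n ] ∑[ k < n ] f (i , j , k)) i))

  -- Membership indicators mediate: by induction a list without repetition is no longer than their
  -- sum, and each is at most the indicator of `P`.
  length≤∑³ : {P : Triple n → Set} (P? : ∀ t → Dec (P t)) {ts : List (Triple n)} →
              Unique ts → (∀ {t} → t ∈ ts → P t) → length ts ≤ ∑³ (𝟙 ∘ P?)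
  length≤∑³ {n} P? unique P = ≤-trans (bound unique)
    (∑³-mono λ t → 𝟙≤ (t ∈? _) λ t∈ts → 1≤𝟙 (P? t) (P t∈ts))
    where
    open import Data.List.Membership.DecPropositional (_≟³_ {n}) using (_∈?_)
    bound : ∀ {ts} → Unique ts → length ts ≤ ∑³ (λ t → 𝟙 (t ∈? ts))
    bound []                   = z≤n
    bound {t ∷ ts} (t∉ts ∷ unique) = begin
      1 + length ts
        ≤⟨ +-mono-≤ (≤-trans (1≤𝟙 (t ≟³ t) refl) (term≤∑³ (λ s → 𝟙 (s ≟³ t)) t)) (bound unique) ⟩
      ∑³ (λ s → 𝟙 (s ≟³ t)) + ∑³ (λ s → 𝟙 (s ∈? ts))
        ≡⟨ ∑³-+ (λ s → 𝟙 (s ≟³ t)) (λ s → 𝟙 (s ∈? ts)) ⟨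
      ∑³ (λ s → 𝟙 (s ≟³ t) + 𝟙 (s ∈? ts))
        ≤⟨ ∑³-mono (λ s → 𝟙-disjoint (s ≟³ t)
             (λ { refl → 𝟙≡0 (s ∈? ts) λ s∈ts → All.lookup t∉ts s∈ts refl })
             (λ s≡t → 1≤𝟙 (s ∈? (t ∷ ts)) (here s≡t))
             (𝟙≤ (s ∈? ts) λ s∈ts → 1≤𝟙 (s ∈? (t ∷ ts)) (there s∈ts))) ⟩
      ∑³ (λ s → 𝟙 (s ∈? (t ∷ ts))) ∎
      where open ≤-Reasoning

  -- With `m = t + 6 q` and `t < 6`, the right side exceeds the left by exactly `12 q + t (6 - t)`.
  arithmetic : ∀ m → let q = m / 6 in
    24 * (q * suc m) + 9 * ((m ∸ (q + q)) * (m ∸ (q + q))) ≤ 2 * ((4 * suc m ∸ 1) * m)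
  arithmetic m with m / 6 | m % 6 | m≡m%n+[m/n]*n m 6 | m%n<n m 6
  ... | q | t | refl | t<6 = begin
    24 * (q * suc (t + q * 6)) + 9 * ((t + q * 6 ∸ (q + q)) * (t + q * 6 ∸ (q + q)))
      ≡⟨ cong (λ k → 24 * (q * suc (t + q * 6)) + 9 * (k * k))
           (trans (cong (_∸ (q + q)) (split t q)) (m+n∸n≡m (t + q * 4) (q + q))) ⟩
    24 * (q * suc (t + q * 6)) + 9 * ((t + q * 4) * (t + q * 4))
      ≤⟨ m≤m+n _ (12 * q + t * (6 ∸ t)) ⟩
    24 * (q * suc (t + q * 6)) + 9 * ((t + q * 4) * (t + q * 4)) + (12 * q + t * (6 ∸ t))
      -- `poly` has a variable `u` in place of `6 ∸ t`; adding `t * 6` to both sides lets `u + t` be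
      -- replaced by `6`. The factor `4 * suc k ∸ 1` computes to `k + 3 * suc k`.
      ≡⟨ +-cancelʳ-≡ (t * 6) _ _ (trans (poly t (6 ∸ t) q)
           (cong (λ k → 2 * ((4 * suc (t + q * 6) ∸ 1) * (t + q * 6)) + t * k)
             (m∸n+n≡m (<⇒≤ t<6)))) ⟩
    2 * ((4 * suc (t + q * 6) ∸ 1) * (t + q * 6)) ∎
    where
    open ≤-Reasoning
    split : ∀ t q → t + q * 6 ≡ t + q * 4 + (q + q)
    split = solve-∀
    poly : ∀ t u q →
      24 * (q * suc (t + q * 6)) + 9 * ((t + q * 4) * (t + q * 4)) + (12 * q + t * u) + t * 6 ≡
      2 * ((t + q * 6 + 3 * suc (t + q * 6)) * (t + q * 6)) + t * (u + t)
    poly = solve-∀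

  -- For points in the plane, Turn (z , y , x) says that the rotation R by 60
  -- degrees about z takes x to y, and _≺ₖ_ compares the images of two points
  -- under Rᵏ.
  record RotationSystem (m : ℕ) : Set₁ where
    field
      _≺₀_ _≺₁_ _≺₂_ : Rel (Fin (suc m)) 0ℓ
      order₀ : IsStrictTotalOrder _≡_ _≺₀_
      order₁ : IsStrictTotalOrder _≡_ _≺₁_
      order₂ : IsStrictTotalOrder _≡_ _≺₂_
      Turn   : Triple (suc m) → Set
      Turn?  : ∀ t → Dec (Turn t)
      functional : ∀ {z y x x′} → Turn (z , y , x) → Turn (z , y , x′) → x ≡ x′
      injective  : ∀ {z y y′ x} → Turn (z , y , x) → Turn (z , y′ , x) → y ≡ y′
      irreflexive : ∀ {z y x} → Turn (z , y , x) → z ≢ y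
      cyclic : ∀ {z y x} → Turn (z , y , x) → Turn (y , x , z)
      up₀₁   : ∀ {z y x} → Turn (z , y , x) → z ≺₀ y → z ≺₁ x
      down₀₁ : ∀ {z y x} → Turn (z , y , x) → y ≺₀ z → x ≺₁ z
      up₁₂   : ∀ {z y x} → Turn (z , y , x) → z ≺₁ y → z ≺₂ x
      down₁₂ : ∀ {z y x} → Turn (z , y , x) → y ≺₁ z → x ≺₂ z
      up₂₀   : ∀ {z y x} → Turn (z , y , x) → z ≺₂ y → x ≺₀ z
      down₂₀ : ∀ {z y x} → Turn (z , y , x) → y ≺₂ z → z ≺₀ x

  -- Bounding the turns at a vertex.

  module Counting {m : ℕ} (S : RotationSystem m) where
    open RotationSystem S
    module R₀ = Ranks order₀
    module R₁ = Ranks order₁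
    module R₂ = Ranks order₂

    degree : Fin (suc m) → ℕ
    degree z = ∑[ y < suc m ] ∑[ x < suc m ] 𝟙 (Turn? (z , y , x))

    private
      module O₀ = IsStrictTotalOrder order₀
      module O₁ = IsStrictTotalOrder order₁
      module O₂ = IsStrictTotalOrder order₂

      side : {_≺_ : Rel (Fin (suc m)) 0ℓ} → IsStrictTotalOrder _≡_ _≺_ → ∀ {z y} → z ≢ y → z ≺ y ⊎ y ≺ z
      side order {z} {y} z≢y with IsStrictTotalOrder.compare order z y
      ... | tri< z≺y _ _ = inj₁ z≺y
      ... | tri≈ _ z≡y _ = contradiction z≡y z≢y
      ... | tri> _ _ y≺z = inj₂ y≺z

      -- A turn has `y` in `A`, or `y` in `A′` and hence `x` in `B′`, so `A` and `B′` cover the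
      -- matching. Exchanging the two sides gives the cover by `A′` and `B`.
      degree≤ : ∀ z {A A′ B B′ : Fin (suc m) → Set} →
        (A? : ∀ y → Dec (A y)) (A′? : ∀ y → Dec (A′ y)) →
        (B? : ∀ x → Dec (B x)) (B′? : ∀ x → Dec (B′ x)) →
        (∀ {y} → z ≢ y → A y ⊎ A′ y) →
        (∀ {y x} → Turn (z , y , x) → A y → B x) →
        (∀ {y x} → Turn (z , y , x) → A′ y → B′ x) →
        degree z ≤ ∑[ y < suc m ] 𝟙 (A? y)  + ∑[ x < suc m ] 𝟙 (B′? x) ×
        degree z ≤ ∑[ y < suc m ] 𝟙 (A′? y) + ∑[ x < suc m ] 𝟙 (B? x)
      degree≤ z A? A′? B? B′? dichotomy A→B A′→B′ =
        matching≤cover (λ y x → Turn? (z , y , x)) A? B′? functional injective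
          (λ t → Sum.map₂ (A′→B′ t) (dichotomy (irreflexive t))) ,
        matching≤cover (λ y x → Turn? (z , y , x)) A′? B? functional injective
          (λ t → Sum.map₂ (A→B t) (Sum.swap (dichotomy (irreflexive t))))

      -- Consider in each order the side attaining the minimum. The bounds serve orders 0 and 1 if
      -- their sides differ, orders 1 and 2 if theirs differ, and orders 2 and 0 if theirs agree.
      -- When the first two cases fail, all sides agree and the third applies.
      two-of-three : ∀ {d} (a a′ b b′ c c′ : ℕ) →
        d ≤ a + b′ × d ≤ a′ + b → d ≤ b + c′ × d ≤ b′ + c → d ≤ c + a × d ≤ c′ + a′ →
        d ≤ a ⊓ a′ + b ⊓ b′ ⊎ d ≤ b ⊓ b′ + c ⊓ c′ ⊎ d ≤ c ⊓ c′ + a ⊓ a′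
      two-of-three a a′ b b′ c c′ (ab′ , a′b) (bc′ , b′c) (ca , c′a′)
        with ⊓-sel a a′ | ⊓-sel b b′ | ⊓-sel c c′
      ... | inj₁ p | inj₂ q | _      rewrite p | q = inj₁ ab′
      ... | inj₂ p | inj₁ q | _      rewrite p | q = inj₁ a′b
      ... | inj₁ p | inj₁ _ | inj₁ r rewrite p | r = inj₂ (inj₂ ca)
      ... | inj₁ _ | inj₁ q | inj₂ r rewrite q | r = inj₂ (inj₁ bc′)
      ... | inj₂ _ | inj₂ q | inj₁ r rewrite q | r = inj₂ (inj₁ b′c)
      ... | inj₂ p | inj₂ _ | inj₂ r rewrite p | r = inj₂ (inj₂ c′a′)

    module _ (q : ℕ) where

      -- Since `l ≤ q + (l ∸ q)`, three times a sum of two depths is at most `6 q` plus three times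
      -- both excesses. Giving each of the three orders a share of `2 q` makes the bound independent
      -- of which two depths occur.
      weight : ℕ → ℕ
      weight l = 2 * q + 3 * (l ∸ q)

      private
        weight-mono : ∀ {a b} → a ≤ b → weight a ≤ weight b
        weight-mono a≤b = +-monoʳ-≤ (2 * q) (*-monoʳ-≤ 3 (∸-monoˡ-≤ q a≤b))

        3a+3b≤ : ∀ {d} a b c → d ≤ a + b → 3 * d ≤ weight a + weight b + weight c
        3a+3b≤ {d} a b c d≤a+b = begin
          3 * d
            ≤⟨ *-monoʳ-≤ 3 (≤-trans d≤a+b (+-mono-≤ (m≤n+m∸n a q) (m≤n+m∸n b q))) ⟩
          3 * ((q + (a ∸ q)) + (q + (b ∸ q)))
            ≡⟨ regroup q (a ∸ q) (b ∸ q) ⟩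
          weight a + weight b + 2 * q
            ≤⟨ +-monoʳ-≤ (weight a + weight b) (m≤m+n (2 * q) _) ⟩
          weight a + weight b + weight c ∎
          where
          open ≤-Reasoning
          regroup : ∀ q a b → 3 * ((q + a) + (q + b)) ≡ (2 * q + 3 * a) + (2 * q + 3 * b) + 2 * q
          regroup = solve-∀

        depth₀ depth₁ depth₂ : Fin (suc m) → ℕ
        depth₀ z = weight (R₀.above z ⊓ R₀.below z)
        depth₁ z = weight (R₁.above z ⊓ R₁.below z)
        depth₂ z = weight (R₂.above z ⊓ R₂.below z)

      private
        3*≤ : ∀ {d} a b c → d ≤ a + b ⊎ d ≤ b + c ⊎ d ≤ c + a → 3 * d ≤ weight a + weight b + weight c
        3*≤ a b c (inj₁ d≤)        = 3a+3b≤ a b c d≤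
        3*≤ a b c (inj₂ (inj₁ d≤)) = ≤-trans (3a+3b≤ b c a d≤)
          (≤-reflexive (rotate (weight b) (weight c) (weight a)))
          where
          rotate : ∀ a b c → a + b + c ≡ c + a + b
          rotate = solve-∀
        3*≤ a b c (inj₂ (inj₂ d≤)) = ≤-trans (3a+3b≤ c a b d≤)
          (≤-reflexive (rotate (weight c) (weight a) (weight b)))
          where
          rotate : ∀ a b c → a + b + c ≡ b + c + a
          rotate = solve-∀

      3*degree≤ : ∀ z → 3 * degree z ≤ depth₀ z + depth₁ z + depth₂ z
      3*degree≤ z = 3*≤ {degree z} (R₀.above z ⊓ R₀.below z) (R₁.above z ⊓ R₁.below z) (R₂.above z ⊓ R₂.below z)
        (two-of-three {degree z}
          (R₀.above z) (R₀.below z) (R₁.above z) (R₁.below z) (R₂.above z) (R₂.below z)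
          (degree≤ z (z O₀.<?_) (O₀._<? z) (z O₁.<?_) (O₁._<? z) (side order₀) up₀₁ down₀₁)
          (degree≤ z (z O₁.<?_) (O₁._<? z) (z O₂.<?_) (O₂._<? z) (side order₁) up₁₂ down₁₂)
          -- The sides of the zeroth order are exchanged because R³ is the half turn; each cover
          -- then takes the same side in both orders.
          (degree≤ z (z O₂.<?_) (O₂._<? z) (O₀._<? z) (z O₀.<?_) (side order₂) up₂₀ down₂₀))

      ∑-degree≤ : ∑³ (𝟙 ∘ Turn?) ≤ ∑-depths m weight
      ∑-degree≤ = *-cancelˡ-≤ 3 (begin
        3 * ∑[ z < suc m ] degree z
          ≡⟨ *-distribˡ-sum 3 degree ⟩
        ∑[ z < suc m ] (3 * degree z)
          ≤⟨ ∑-mono 3*degree≤ ⟩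
        ∑[ z < suc m ] (depth₀ z + depth₁ z + depth₂ z)
          ≡⟨ trans (∑-distrib-+ (λ z → depth₀ z + depth₁ z) depth₂)
                   (cong (_+ ∑[ z < suc m ] depth₂ z) (∑-distrib-+ depth₀ depth₁)) ⟩
        ∑[ z < suc m ] depth₀ z + ∑[ z < suc m ] depth₁ z + ∑[ z < suc m ] depth₂ z
          ≤⟨ +-mono-≤ (+-mono-≤ (R₀.∑-depth weight weight-mono) (R₁.∑-depth weight weight-mono))
                      (R₂.∑-depth weight weight-mono) ⟩
        ∑-depths m weight + ∑-depths m weight + ∑-depths m weight
          ≡⟨ thrice (∑-depths m weight) ⟩
        3 * ∑-depths m weight ∎)
        where
        open ≤-Reasoning
        thrice : ∀ a → a + a + a ≡ 3 * a
        thrice = solve-∀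

    -- From triangles to turns.

    Sorted : Triple (suc m) → Set
    Sorted (i , j , k) = i Fin.< j × j Fin.< k

    Triangular : Triple (suc m) → Set
    Triangular t = Sorted t × (Turn t ⊎ Turn (swap t))

    private
      Triangular? : ∀ t → Dec (Triangular t)
      Triangular? t@(i , j , k) = (i Fin.<? j ×-dec j Fin.<? k) ×-dec (Turn? t ⊎-dec Turn? (swap t))

      -- Exactly one cyclic rotation of a turn is normal.
      Normal : Triple (suc m) → Set
      Normal t@(i , j , k) = (i Fin.< j × i Fin.< k) × Turn t

      Normal? : ∀ t → Dec (Normal t)
      Normal? t@(i , j , k) = (i Fin.<? j ×-dec i Fin.<? k) ×-dec Turn? t

    -- A sum over all triples is invariant under `turn`. By `cyclic` the three rotations of a triple
    -- are turns together, and at most one of them starts with its least index.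
    3*∑-normal≤ : 3 * ∑³ (𝟙 ∘ Normal?) ≤ ∑³ (𝟙 ∘ Turn?)
    3*∑-normal≤ = begin
      3 * ∑³ (𝟙 ∘ Normal?)
        ≡⟨ thrice (∑³ normal) ⟩
      ∑³ normal + (∑³ normal + ∑³ normal)
        ≡⟨ cong (∑³ normal +_) (cong₂ _+_ (∑³-turn normal)
             (trans (∑³-turn (normal ∘ turn)) (∑³-turn normal))) ⟨
      ∑³ normal + (∑³ (normal ∘ turn) + ∑³ (normal ∘ turn ∘ turn))
        ≡⟨ cong (∑³ normal +_) (∑³-+ (normal ∘ turn) (normal ∘ turn ∘ turn)) ⟨
      ∑³ normal + ∑³ (λ t → normal (turn t) + normal (turn (turn t)))
        ≡⟨ ∑³-+ normal (λ t → normal (turn t) + normal (turn (turn t))) ⟨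
      ∑³ (λ t → normal t + (normal (turn t) + normal (turn (turn t))))
        ≤⟨ ∑³-mono exclusive ⟩
      ∑³ (𝟙 ∘ Turn?) ∎
      where
      open ≤-Reasoning
      normal = 𝟙 ∘ Normal?
      thrice : ∀ a → 3 * a ≡ a + (a + a)
      thrice = solve-∀
      exclusive : ∀ t → normal t + (normal (turn t) + normal (turn (turn t))) ≤ 𝟙 (Turn? t)
      exclusive t@(i , j , k) = 𝟙-disjoint (Normal? t)
        (λ ((i<j , i<k) , _) → cong₂ _+_
          (𝟙≡0 (Normal? (turn t)) λ ((_ , j<i) , _) → <-asym i<j j<i)
          (𝟙≡0 (Normal? (turn (turn t))) λ ((k<i , _) , _) → <-asym i<k k<i))
        (λ (_ , τ) → 1≤𝟙 (Turn? t) τ)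
        (𝟙-disjoint (Normal? (turn t))
          (λ ((j<k , _) , _) → 𝟙≡0 (Normal? (turn (turn t))) λ ((_ , k<j) , _) → <-asym j<k k<j)
          (λ (_ , τ) → 1≤𝟙 (Turn? t) (cyclic (cyclic τ)))
          (𝟙≤ (Normal? (turn (turn t))) λ (_ , τ) → 1≤𝟙 (Turn? t) (cyclic τ)))

    -- Doubling both sides allows summation over the pairs `t`, `swap t`. At most one of the two is
    -- sorted, and a turn of either orientation on it starts with the least index, so it is normal.
    ∑-triangular≤ : ∑³ (𝟙 ∘ Triangular?) ≤ ∑³ (𝟙 ∘ Normal?)
    ∑-triangular≤ = *-cancelˡ-≤ 2 (begin
      2 * ∑³ triangular
        ≡⟨ double triangular ⟩
      ∑³ (λ t → triangular t + triangular (swap t))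
        ≤⟨ ∑³-mono (λ t@(i , j , k) → 𝟙-disjoint (Triangular? t)
             (λ ((_ , j<k) , _) → 𝟙≡0 (Triangular? (swap t)) λ ((_ , k<j) , _) → <-asym j<k k<j)
             (oriented t)
             (𝟙≤ (Triangular? (swap t)) λ p → ≤-trans (oriented (swap t) p)
               (≤-reflexive (+-comm (normal (swap t)) (normal t))))) ⟩
      ∑³ (λ t → normal t + normal (swap t))
        ≡⟨ double normal ⟨
      2 * ∑³ normal ∎)
      where
      open ≤-Reasoning
      triangular = 𝟙 ∘ Triangular?
      normal = 𝟙 ∘ Normal?
      double : ∀ f → 2 * ∑³ f ≡ ∑³ (λ t → f t + f (swap t))
      double f = trans (cong (∑³ f +_) (trans (+-identityʳ (∑³ f)) (sym (∑³-swap f))))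
                       (sym (∑³-+ f (f ∘ swap)))
      oriented : ∀ t → Triangular t → 1 ≤ normal t + normal (swap t)
      oriented t@(i , j , k) ((i<j , j<k) , inj₁ τ) =
        m≤n⇒m≤n+o (normal (swap t)) (1≤𝟙 (Normal? t) ((i<j , <-trans i<j j<k) , τ))
      oriented t@(i , j , k) ((i<j , j<k) , inj₂ τ) =
        m≤n⇒m≤o+n (normal t) (1≤𝟙 (Normal? (swap t)) ((<-trans i<j j<k , i<j) , τ))

    length≤ : ∀ {ts} → Unique ts →
              (∀ i j k → (i , j , k) ∈ ts →
               (i Fin.< j × j Fin.< k) × (Turn (i , j , k) ⊎ Turn (i , k , j))) →
              length ts ≤ ((4 * suc m ∸ 1) * m) / 18
    length≤ {ts} unique triangular = subst (_≤ ((4 * suc m ∸ 1) * m) / 18) (m*n/n≡m (length ts) 18)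
      -- The scale is `36 = 2 * 18 = 12 * 3`: the `2` matches `arithmetic`, and the `12` supplies
      -- the factor `4` in `∑-depths-∸`.
      (/-monoˡ-≤ 18 (*-cancelˡ-≤ {length ts * 18} {(4 * suc m ∸ 1) * m} 2 (begin
        2 * (length ts * 18)
          ≡⟨ scale (length ts) ⟩
        12 * (3 * length ts)
          ≤⟨ *-monoʳ-≤ 12 (≤-trans
               (*-monoʳ-≤ 3 (≤-trans (length≤∑³ Triangular? unique λ {t} → triangular _ _ _) ∑-triangular≤))
               (≤-trans 3*∑-normal≤ (∑-degree≤ q))) ⟩
        12 * ∑-depths m (weight q)
          ≡⟨ cong (12 *_) (trans
               (∑-distrib-+ {suc m} (λ _ → 2 * q) (λ l → 3 * (depth l ∸ q)))
               (cong₂ _+_ (∑-const (suc m) (2 * q))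
                          (sym (*-distribˡ-sum {suc m} 3 (λ l → depth l ∸ q))))) ⟩
        12 * (suc m * (2 * q) + 3 * ∑-depths m (_∸ q))
          ≡⟨ expand (suc m) q (∑-depths m (_∸ q)) ⟩
        24 * (q * suc m) + 9 * (4 * ∑-depths m (_∸ q))
          ≤⟨ +-monoʳ-≤ (24 * (q * suc m)) (*-monoʳ-≤ 9 (∑-depths-∸ m q)) ⟩
        24 * (q * suc m) + 9 * ((m ∸ (q + q)) * (m ∸ (q + q)))
          ≤⟨ arithmetic m ⟩
        2 * ((4 * suc m ∸ 1) * m) ∎)))
      where
      open ≤-Reasoning
      -- The bound is quadratic in q, with minimum at (m - 2) / 6.
      q = m / 6
      depth : Fin (suc m) → ℕ
      depth l = toℕ l ⊓ (m ∸ toℕ l)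
      scale : ∀ a → 2 * (a * 18) ≡ 12 * (3 * a)
      scale = solve-∀
      expand : ∀ a q b → 12 * (a * (2 * q) + 3 * b) ≡ 24 * (q * a) + 9 * (4 * b)
      expand = solve-∀

-- Null sequences of Cauchy reals.

module Plane where

  open import Data.List.Base using (length)
  open import Data.List.Membership.Propositional using (_∈_)
  open import Data.List.Relation.Unary.Unique.Propositional using (Unique)
  import Data.Integer.Base as ℤ
  open import Data.Nat.Base as ℕ using (ℕ; zero; suc; z≤n; s≤s)
  import Data.Nat.Properties as ℕ
  open import Data.Rational.Base as ℚ
    using (ℚ; mkℚ; 0ℚ; 1ℚ; ½; ∣_∣; Positive; positive; nonNegative; 1/_; toℚᵘ)
  import Data.Rational.Properties as ℚ
  open import Data.Rational.Solver using (module +-*-Solver)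
  import Data.Rational.Unnormalised.Base as ℚᵘ
  import Data.Rational.Unnormalised.Properties as ℚᵘ
  open import Defs hiding (_≤_)
  open +-*-Solver
  open Combinatorics using (RotationSystem; module Counting)

  ¬¬-all : ∀ {n} {P : Fin n → Set} → (∀ i → ¬ ¬ P i) → ¬ ¬ (∀ i → P i)
  ¬¬-all = Fin.sequence (RawMonad.rawApplicative ¬¬-Monad)

  -- This recovers an honest disjunction from one known only up to double negation.
  or-by-cases : {A B : Set} → Dec A → Dec B → (¬ A → ¬ ¬ B) → A ⊎ B
  or-by-cases (yes a) _       _     = inj₁ a
  or-by-cases (no _)  (yes b) _     = inj₂ b
  or-by-cases (no ¬a) (no ¬b) ¬a⇒¬¬b = contradiction ¬b (¬a⇒¬¬b ¬a)

  -- In this form `x ≈ y` is the same condition as `Zero (x - y)`, so algebraic relations become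
  -- memberships in an ideal.
  record Zero (x : ℝ) : Set where
    constructor mkZero
    field vanishes : ∀ ε → 0ℚ ℚ.< ε → ∃[ N ] (∀ n → N ℕ.≤ n → ∣ seq x n ∣ ℚ.≤ ε)

  open Zero

  private variable x y h₁ h₂ h₃ : ℝ

  half-pos : ∀ {ε} → 0ℚ ℚ.< ε → 0ℚ ℚ.< ½ ℚ.* ε
  half-pos {ε} 0<ε = ℚ.positive⁻¹ _ {{ℚ.pos*pos⇒pos ½ ε {{positive 0<ε}}}}

  half+half : ∀ ε → ½ ℚ.* ε ℚ.+ ½ ℚ.* ε ≡ ε
  half+half = solve 1 (λ ε → con ½ :* ε :+ con ½ :* ε := ε) refl

  zero-+ : Zero x → Zero y → Zero (x + y)
  zero-+ {x} {y} x≈0 y≈0 = mkZero λ ε 0<ε →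
    let N₁ , bound₁ = vanishes x≈0 (½ ℚ.* ε) (half-pos 0<ε)
        N₂ , bound₂ = vanishes y≈0 (½ ℚ.* ε) (half-pos 0<ε)
    in N₁ ℕ.⊔ N₂ , λ n N≤n → begin
    ∣ seq x n ℚ.+ seq y n ∣      ≤⟨ ℚ.∣p+q∣≤∣p∣+∣q∣ (seq x n) (seq y n) ⟩
    ∣ seq x n ∣ ℚ.+ ∣ seq y n ∣  ≤⟨ ℚ.+-mono-≤ (bound₁ n (ℕ.m⊔n≤o⇒m≤o N₁ N₂ N≤n))
                                               (bound₂ n (ℕ.m⊔n≤o⇒n≤o N₁ N₂ N≤n)) ⟩
    ½ ℚ.* ε ℚ.+ ½ ℚ.* ε          ≡⟨ half+half ε ⟩
    ε                            ∎
    where open ℚ.≤-Reasoning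

  bounded : ∀ x → ∃[ M ] Positive M × ∃[ N ] (∀ n → N ℕ.≤ n → ∣ seq x n ∣ ℚ.≤ M)
  bounded x with N , close ← cauchy x 1ℚ (ℚ.positive⁻¹ 1ℚ) =
    ∣ seq x N ∣ ℚ.+ 1ℚ ,
    ℚ.nonNeg+pos⇒pos ∣ seq x N ∣ {{nonNegative (ℚ.0≤∣p∣ (seq x N))}} 1ℚ ,
    N , λ n N≤n → begin
      ∣ seq x n ∣                                ≡⟨ cong ∣_∣ (shift (seq x N) (seq x n)) ⟩
      ∣ seq x N ℚ.+ (seq x n ℚ.- seq x N) ∣      ≤⟨ ℚ.∣p+q∣≤∣p∣+∣q∣ (seq x N) _ ⟩
      ∣ seq x N ∣ ℚ.+ ∣ seq x n ℚ.- seq x N ∣    ≤⟨ ℚ.+-monoʳ-≤ ∣ seq x N ∣ (close n N N≤n ℕ.≤-refl) ⟩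
      ∣ seq x N ∣ ℚ.+ 1ℚ                         ∎
    where
    open ℚ.≤-Reasoning
    shift : ∀ a b → b ≡ a ℚ.+ (b ℚ.- a)
    shift = solve 2 (λ a b → b := a :+ (b :- a)) refl

  divide : ∀ K → Positive K → ∀ ε → 0ℚ ℚ.< ε → ∃[ δ ] 0ℚ ℚ.< δ × K ℚ.* δ ≡ ε
  divide K K>0 ε 0<ε = 1/ K ℚ.* ε , 0<δ , (begin
    K ℚ.* (1/ K ℚ.* ε)  ≡⟨ ℚ.*-assoc K (1/ K) ε ⟨
    K ℚ.* 1/ K ℚ.* ε    ≡⟨ cong (ℚ._* ε) (ℚ.*-inverseʳ K) ⟩
    1ℚ ℚ.* ε            ≡⟨ ℚ.*-identityˡ ε ⟩
    ε                   ∎)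
    where
    open ≡-Reasoning
    instance
      K-nonZero : ℚ.NonZero K
      K-nonZero = ℚ.pos⇒nonZero K {{K>0}}
    0<δ : 0ℚ ℚ.< 1/ K ℚ.* ε
    0<δ = ℚ.positive⁻¹ _
      {{ℚ.pos*pos⇒pos (1/ K) {{ℚ.1/pos⇒pos K {{K>0}}}} ε {{positive 0<ε}}}}

  -- If `x` is eventually bounded by `M`, it suffices that `y` is eventually within `ε / M`.
  zero-* : ∀ x → Zero y → Zero (x * y)
  zero-* {y} x y≈0 = mkZero λ ε 0<ε → go ε 0<ε (bounded x)
    where
    open ℚ.≤-Reasoning
    Tail : (ℕ → ℚ) → ℚ → Set
    Tail a δ = ∃[ N ] (∀ n → N ℕ.≤ n → ∣ a n ∣ ℚ.≤ δ)

    product : ∀ {M δ} → Positive M → Tail (seq x) M → Tail (seq y) δ → Tail (seq (x * y)) (M ℚ.* δ)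
    product {M} {δ} M>0 (N₁ , x≤M) (N₂ , y≤δ) = N₁ ℕ.⊔ N₂ , λ n N≤n → begin
      ∣ seq x n ℚ.* seq y n ∣
        ≡⟨ ℚ.∣p*q∣≡∣p∣*∣q∣ (seq x n) (seq y n) ⟩
      ∣ seq x n ∣ ℚ.* ∣ seq y n ∣
        ≤⟨ ℚ.*-monoʳ-≤-nonNeg ∣ seq y n ∣ {{nonNegative (ℚ.0≤∣p∣ (seq y n))}}
             (x≤M n (ℕ.m⊔n≤o⇒m≤o N₁ N₂ N≤n)) ⟩
      M ℚ.* ∣ seq y n ∣
        ≤⟨ ℚ.*-monoˡ-≤-nonNeg M {{ℚ.pos⇒nonNeg M {{M>0}}}} (y≤δ n (ℕ.m⊔n≤o⇒n≤o N₁ N₂ N≤n)) ⟩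
      M ℚ.* δ ∎

    go : ∀ ε → 0ℚ ℚ.< ε → ∃[ M ] Positive M × Tail (seq x) M → Tail (seq (x * y)) ε
    go ε 0<ε (M , M>0 , x≤M) = go′ (divide M M>0 ε 0<ε)
      where
      go′ : ∃[ δ ] 0ℚ ℚ.< δ × M ℚ.* δ ≡ ε → Tail (seq (x * y)) ε
      go′ (δ , 0<δ , Mδ≡ε) = subst (Tail (seq (x * y))) Mδ≡ε (product M>0 x≤M (vanishes y≈0 δ 0<δ))

  -- Null sequences form an ideal of the ring of Cauchy sequences; the linear
  -- relations are required pointwise, where the ring solver for ℚ applies.

  zero-cong : (∀ n → seq y n ≡ seq x n) → Zero x → Zero y
  zero-cong y≗x x≈0 = mkZero λ ε 0<ε → let N , bound = vanishes x≈0 ε 0<ε in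
    N , λ n N≤n → subst (λ q → ∣ q ∣ ℚ.≤ ε) (sym (y≗x n)) (bound n N≤n)

  zero₀ : (∀ n → seq y n ≡ 0ℚ) → Zero y
  zero₀ y≗0 = mkZero λ ε 0<ε → 0 , λ n _ →
    ℚ.≤-trans (ℚ.≤-reflexive (cong ∣_∣ (y≗0 n))) (ℚ.<⇒≤ 0<ε)

  zero₁ : ∀ c → Zero h₁ → (∀ n → seq y n ≡ seq c n ℚ.* seq h₁ n) → Zero y
  zero₁ {h₁} c h₁≈0 y≗ = zero-cong {x = c * h₁} y≗ (zero-* {h₁} c h₁≈0)

  zero₂ : ∀ c₁ c₂ → Zero h₁ → Zero h₂ →
          (∀ n → seq y n ≡ seq c₁ n ℚ.* seq h₁ n ℚ.+ seq c₂ n ℚ.* seq h₂ n) → Zero y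
  zero₂ {h₁} {h₂} c₁ c₂ h₁≈0 h₂≈0 y≗ = zero-cong {x = c₁ * h₁ + c₂ * h₂} y≗
    (zero-+ {c₁ * h₁} {c₂ * h₂} (zero-* {h₁} c₁ h₁≈0) (zero-* {h₂} c₂ h₂≈0))

  zero₃ : ∀ c₁ c₂ c₃ → Zero h₁ → Zero h₂ → Zero h₃ →
          (∀ n → seq y n ≡ seq c₁ n ℚ.* seq h₁ n ℚ.+ seq c₂ n ℚ.* seq h₂ n ℚ.+ seq c₃ n ℚ.* seq h₃ n) →
          Zero y
  zero₃ {h₁} {h₂} {h₃} c₁ c₂ c₃ h₁≈0 h₂≈0 h₃≈0 y≗ = zero-cong {x = c₁ * h₁ + c₂ * h₂ + c₃ * h₃} y≗
    (zero-+ {c₁ * h₁ + c₂ * h₂} {c₃ * h₃}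
      (zero-+ {c₁ * h₁} {c₂ * h₂} (zero-* {h₁} c₁ h₁≈0) (zero-* {h₂} c₂ h₂≈0))
      (zero-* {h₃} c₃ h₃≈0))

  -- Signs of Cauchy reals.

  record Pos (x : ℝ) : Set where
    constructor mkPos
    field
      gap       : ℚ
      0<gap     : 0ℚ ℚ.< gap
      threshold : ℕ
      gap≤      : ∀ n → threshold ℕ.≤ n → gap ℚ.≤ seq x n

  pos-+ : Pos h₁ → Pos h₂ → (∀ n → seq y n ≡ seq h₁ n ℚ.+ seq h₂ n) → Pos y
  pos-+ (mkPos ε 0<ε N₁ bound₁) (mkPos δ 0<δ N₂ bound₂) y≗ =
    mkPos (ε ℚ.+ δ) (ℚ.+-mono-< 0<ε 0<δ) (N₁ ℕ.⊔ N₂) λ n N≤n →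
      subst (ε ℚ.+ δ ℚ.≤_) (sym (y≗ n))
        (ℚ.+-mono-≤ (bound₁ n (ℕ.m⊔n≤o⇒m≤o N₁ N₂ N≤n)) (bound₂ n (ℕ.m⊔n≤o⇒n≤o N₁ N₂ N≤n)))

  p≤∣p∣ : ∀ p → p ℚ.≤ ∣ p ∣
  p≤∣p∣ p with ℚ.≤-total 0ℚ p
  ... | inj₁ 0≤p = ℚ.≤-reflexive (sym (ℚ.0≤p⇒∣p∣≡p 0≤p))
  ... | inj₂ p≤0 = ℚ.≤-trans p≤0 (ℚ.0≤∣p∣ p)

  -∣p∣≤p : ∀ p → ℚ.- ∣ p ∣ ℚ.≤ p
  -∣p∣≤p p = subst (ℚ.- ∣ p ∣ ℚ.≤_) (solve 1 (λ p → :- :- p := p) refl p)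
    (ℚ.neg-antimono-≤ (subst (ℚ.- p ℚ.≤_) (ℚ.∣-p∣≡∣p∣ p) (p≤∣p∣ (ℚ.- p))))

  pos-cong : Pos x → (∀ n → seq y n ≡ seq x n) → Pos y
  pos-cong (mkPos ε 0<ε N ε≤x) y≗x = mkPos ε 0<ε N λ n N≤n → subst (ε ℚ.≤_) (sym (y≗x n)) (ε≤x n N≤n)

  -- A null sequence eventually consumes at most half of the gap.
  pos-shift : Pos h₁ → Zero h₂ → (∀ n → seq y n ≡ seq h₁ n ℚ.+ seq h₂ n) → Pos y
  pos-shift {h₁} {h₂} {y} (mkPos ε 0<ε N₁ ε≤h₁) h₂≈0 y≗ =
    mkPos (½ ℚ.* ε) (half-pos 0<ε) (N₁ ℕ.⊔ N₂) λ n N≤n → begin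
      ½ ℚ.* ε
        ≡⟨ solve 1 (λ ε → con ½ :* ε := ε :- con ½ :* ε) refl ε ⟩
      ε ℚ.- ½ ℚ.* ε
        ≤⟨ ℚ.+-mono-≤ (ε≤h₁ n (ℕ.m⊔n≤o⇒m≤o N₁ N₂ N≤n))
             (ℚ.neg-antimono-≤ (proj₂ tail n (ℕ.m⊔n≤o⇒n≤o N₁ N₂ N≤n))) ⟩
      seq h₁ n ℚ.- ∣ seq h₂ n ∣
        ≤⟨ ℚ.+-monoʳ-≤ (seq h₁ n) (-∣p∣≤p (seq h₂ n)) ⟩
      seq h₁ n ℚ.+ seq h₂ n
        ≡⟨ y≗ n ⟨
      seq y n ∎
    where
    open ℚ.≤-Reasoning
    tail = vanishes h₂≈0 (½ ℚ.* ε) (half-pos 0<ε)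
    N₂ = proj₁ tail

  zero⇒¬pos : Zero x → ¬ Pos x
  zero⇒¬pos {x} x≈0 (mkPos ε 0<ε N₁ ε≤x) = go (ℚ.<-dense 0<ε)
    where
    open ℚ.≤-Reasoning
    -- A bound strictly below the gap is chosen, since nullity yields only weak inequalities.
    go : ¬ (∃[ δ ] 0ℚ ℚ.< δ × δ ℚ.< ε)
    go (δ , 0<δ , δ<ε) = ℚ.<-irrefl refl (begin-strict
      δ            <⟨ δ<ε ⟩
      ε            ≤⟨ ε≤xN ⟩
      seq x N      ≡⟨ ℚ.0≤p⇒∣p∣≡p (ℚ.≤-trans (ℚ.<⇒≤ 0<ε) ε≤xN) ⟨
      ∣ seq x N ∣  ≤⟨ proj₂ (vanishes x≈0 δ 0<δ) N (ℕ.m≤n⊔m N₁ _) ⟩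
      δ            ∎)
      where
      N = N₁ ℕ.⊔ proj₁ (vanishes x≈0 δ 0<δ)
      ε≤xN = ε≤x N (ℕ.m≤m⊔n N₁ _)

  ∣p∣≤ : ∀ {p q} → p ℚ.≤ q → ℚ.- p ℚ.≤ q → ∣ p ∣ ℚ.≤ q
  ∣p∣≤ {p} p≤q -p≤q with ℚ.∣p∣≡p∨∣p∣≡-p p
  ... | inj₁ eq = subst (ℚ._≤ _) (sym eq) p≤q
  ... | inj₂ eq = subst (ℚ._≤ _) (sym eq) -p≤q

  -- A Cauchy sequence that is not eventually above ε/2 lies below ε from some
  -- index on.
  ¬pos⇒≤ : ∀ x → ¬ Pos x → ∀ ε → 0ℚ ℚ.< ε → ∃[ N ] (∀ n → N ℕ.≤ n → seq x n ℚ.≤ ε)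
  ¬pos⇒≤ x ¬pos ε 0<ε = N , bound
    where
    open ℚ.≤-Reasoning
    close = cauchy x (½ ℚ.* ε) (half-pos 0<ε)
    N = proj₁ close
    bound : ∀ n → N ℕ.≤ n → seq x n ℚ.≤ ε
    bound n N≤n with seq x n ℚ.≤? ε
    ... | yes xn≤ε = xn≤ε
    ... | no  xn≰ε = contradiction (mkPos (½ ℚ.* ε) (half-pos 0<ε) N λ k N≤k → begin
      ½ ℚ.* ε
        ≡⟨ solve 1 (λ ε → con ½ :* ε := ε :- con ½ :* ε) refl ε ⟩
      ε ℚ.- ½ ℚ.* ε
        ≤⟨ ℚ.+-mono-≤ (ℚ.<⇒≤ (ℚ.≰⇒> xn≰ε)) (ℚ.≤-trans
             (ℚ.neg-antimono-≤ (proj₂ close k n N≤k N≤n)) (-∣p∣≤p (seq x k ℚ.- seq x n))) ⟩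
      seq x n ℚ.+ (seq x k ℚ.- seq x n)
        ≡⟨ solve 2 (λ a b → a :+ (b :- a) := b) refl (seq x n) (seq x k) ⟩
      seq x k ∎) ¬pos

  ¬pos∧¬neg⇒zero : ∀ x → ¬ Pos x → ¬ Pos (- x) → Zero x
  ¬pos∧¬neg⇒zero x ¬pos ¬neg = mkZero λ ε 0<ε →
    let N₁ , bound₁ = ¬pos⇒≤ x ¬pos ε 0<ε
        N₂ , bound₂ = ¬pos⇒≤ (- x) ¬neg ε 0<ε
    in N₁ ℕ.⊔ N₂ , λ n N≤n →
      ∣p∣≤ (bound₁ n (ℕ.m⊔n≤o⇒m≤o N₁ N₂ N≤n)) (bound₂ n (ℕ.m⊔n≤o⇒n≤o N₁ N₂ N≤n))

  -- Once `x ≥ δ`, a bound `δ ε` on the product leaves at most `ε` for `y`.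
  pos-cancel : ∀ x y → Pos x → Zero (x * y) → Zero y
  pos-cancel x y (mkPos δ 0<δ N₁ δ≤x) xy≈0 = mkZero λ ε 0<ε →
    let instance
          δ-positive : Positive δ
          δ-positive = positive 0<δ
        N₂ , bound = vanishes xy≈0 (δ ℚ.* ε) (ℚ.positive⁻¹ _ {{ℚ.pos*pos⇒pos δ ε {{positive 0<ε}}}})
    in N₁ ℕ.⊔ N₂ , λ n N≤n → ℚ.*-cancelˡ-≤-pos δ (begin
      δ ℚ.* ∣ seq y n ∣
        ≤⟨ ℚ.*-monoʳ-≤-nonNeg ∣ seq y n ∣ {{nonNegative (ℚ.0≤∣p∣ (seq y n))}}
             (ℚ.≤-trans (δ≤x n (ℕ.m⊔n≤o⇒m≤o N₁ N₂ N≤n)) (p≤∣p∣ (seq x n))) ⟩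
      ∣ seq x n ∣ ℚ.* ∣ seq y n ∣
        ≡⟨ ℚ.∣p*q∣≡∣p∣*∣q∣ (seq x n) (seq y n) ⟨
      ∣ seq x n ℚ.* seq y n ∣
        ≤⟨ bound n (ℕ.m⊔n≤o⇒n≤o N₁ N₂ N≤n) ⟩
      δ ℚ.* ε ∎)
    where open ℚ.≤-Reasoning

  -- If `y` were not null, `pos-cancel` would rule out both signs of `x`. The double negation arises
  -- because the sign of a nonzero `x` is not decided.
  zero-product : ∀ x y → Zero (x * y) → ¬ Zero x → ¬ ¬ Zero y
  zero-product x y xy≈0 x≉0 y≉0 = x≉0 (¬pos∧¬neg⇒zero x
    (λ x>0 → y≉0 (pos-cancel x y x>0 xy≈0))
    (λ x<0 → y≉0 (pos-cancel (- x) y x<0 (zero₁ (fromℚ (ℚ.- 1ℚ)) xy≈0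
      λ n → solve 2 (λ a b → :- a :* b := con (ℚ.- 1ℚ) :* (a :* b))
              refl (seq x n) (seq y n)))))

  pos-square : ∀ x → Pos x → ∀ y → Pos (x * x + y * y)
  pos-square x (mkPos δ 0<δ N δ≤x) y = mkPos (δ ℚ.* δ)
    (ℚ.positive⁻¹ _ {{ℚ.pos*pos⇒pos δ δ}}) N λ n N≤n → begin
      δ ℚ.* δ
        ≤⟨ ℚ.*-monoˡ-≤-nonNeg δ {{ℚ.pos⇒nonNeg δ}} (δ≤x n N≤n) ⟩
      δ ℚ.* seq x n
        ≤⟨ ℚ.*-monoʳ-≤-nonNeg (seq x n) {{nonNegative (ℚ.≤-trans (ℚ.<⇒≤ 0<δ) (δ≤x n N≤n))}} (δ≤x n N≤n) ⟩
      seq x n ℚ.* seq x n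
        ≡⟨ ℚ.+-identityʳ _ ⟨
      seq x n ℚ.* seq x n ℚ.+ 0ℚ
        ≤⟨ ℚ.+-monoʳ-≤ (seq x n ℚ.* seq x n) (0≤p*p (seq y n)) ⟩
      seq x n ℚ.* seq x n ℚ.+ seq y n ℚ.* seq y n ∎
    where
    open ℚ.≤-Reasoning
    instance
      δ-positive : Positive δ
      δ-positive = positive 0<δ
    0≤p*p : ∀ p → 0ℚ ℚ.≤ p ℚ.* p
    0≤p*p p with ℚ.≤-total 0ℚ p
    ... | inj₁ 0≤p = subst (ℚ._≤ p ℚ.* p) (ℚ.*-zeroʳ p) (ℚ.*-monoˡ-≤-nonNeg p {{nonNegative 0≤p}} 0≤p)
    ... | inj₂ p≤0 = subst (ℚ._≤ p ℚ.* p) (ℚ.*-zeroʳ p) (ℚ.*-monoˡ-≤-nonPos p {{ℚ.nonPositive p≤0}} p≤0)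

  -- With either sign of `x`, its square and hence the sum would stay away from zero.
  zero-squares : ∀ x y → Zero (x * x + y * y) → Zero x
  zero-squares x y sum≈0 = ¬pos∧¬neg⇒zero x
    (λ x>0 → zero⇒¬pos sum≈0 (pos-square x x>0 y))
    (λ x<0 → zero⇒¬pos sum≈0 (pos-cong (pos-square (- x) x<0 y)
      λ n → solve 2 (λ a b → a :* a :+ b :* b := :- a :* :- a :+ b :* b)
              refl (seq x n) (seq y n)))

  -- Construction of the square root of three.

  module √3 where
    open ℚ.≤-Reasoning

    -- 2 - √3 is the fixed point of the contraction d ↦ (1 + d²) / 4 of [0 , 1].
    d : ℕ → ℚ
    d zero    = 0ℚ
    d (suc n) = ½ ℚ.* ½ ℚ.* (1ℚ ℚ.+ d n ℚ.* d n)

    -- The error bound `2⁻ⁿ` after `n` steps of the contraction.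
    r : ℕ → ℚ
    r zero    = 1ℚ
    r (suc n) = ½ ℚ.* r n

    Unit : ℚ → Set
    Unit p = 0ℚ ℚ.≤ p × p ℚ.≤ 1ℚ

    d∈[0,1] : ∀ n → Unit (d n)
    d∈[0,1] zero    = ℚ.≤-refl , from-yes (0ℚ ℚ.≤? 1ℚ)
    d∈[0,1] (suc n) = step (d n) (d∈[0,1] n)
      where
      step : ∀ p → Unit p → Unit (½ ℚ.* ½ ℚ.* (1ℚ ℚ.+ p ℚ.* p))
      step p (0≤p , p≤1) =
        (begin
          0ℚ                                ≤⟨ from-yes (0ℚ ℚ.≤? ½ ℚ.* ½ ℚ.* (1ℚ ℚ.+ 0ℚ)) ⟩
          ½ ℚ.* ½ ℚ.* (1ℚ ℚ.+ 0ℚ)           ≡⟨ cong (λ q → ½ ℚ.* ½ ℚ.* (1ℚ ℚ.+ q)) (ℚ.*-zeroʳ p) ⟨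
          ½ ℚ.* ½ ℚ.* (1ℚ ℚ.+ p ℚ.* 0ℚ)     ≤⟨ scale (ℚ.*-monoˡ-≤-nonNeg p 0≤p) ⟩
          ½ ℚ.* ½ ℚ.* (1ℚ ℚ.+ p ℚ.* p)      ∎) ,
        (begin
          ½ ℚ.* ½ ℚ.* (1ℚ ℚ.+ p ℚ.* p)      ≤⟨ scale (ℚ.*-monoˡ-≤-nonNeg p p≤1) ⟩
          ½ ℚ.* ½ ℚ.* (1ℚ ℚ.+ p ℚ.* 1ℚ)     ≡⟨ cong (λ q → ½ ℚ.* ½ ℚ.* (1ℚ ℚ.+ q)) (ℚ.*-identityʳ p) ⟩
          ½ ℚ.* ½ ℚ.* (1ℚ ℚ.+ p)            ≤⟨ scale p≤1 ⟩
          ½ ℚ.* ½ ℚ.* (1ℚ ℚ.+ 1ℚ)           ≤⟨ from-yes (½ ℚ.* ½ ℚ.* (1ℚ ℚ.+ 1ℚ) ℚ.≤? 1ℚ) ⟩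
          1ℚ                                ∎)
        where
        instance
          p-nonNegative : ℚ.NonNegative p
          p-nonNegative = nonNegative 0≤p
        scale : ∀ {a b} → a ℚ.≤ b → ½ ℚ.* ½ ℚ.* (1ℚ ℚ.+ a) ℚ.≤ ½ ℚ.* ½ ℚ.* (1ℚ ℚ.+ b)
        scale a≤b = ℚ.*-monoˡ-≤-nonNeg (½ ℚ.* ½) (ℚ.+-monoʳ-≤ 1ℚ a≤b)

    -- The difference factors as `½ * m * (p - q)`, where the mean `m` of `p` and `q` lies in the
    -- unit interval.
    contraction : ∀ p q → Unit p → Unit q →
      ∣ ½ ℚ.* ½ ℚ.* (1ℚ ℚ.+ p ℚ.* p) ℚ.- ½ ℚ.* ½ ℚ.* (1ℚ ℚ.+ q ℚ.* q) ∣ ℚ.≤ ½ ℚ.* ∣ p ℚ.- q ∣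
    contraction p q (0≤p , p≤1) (0≤q , q≤1) = begin
      ∣ ½ ℚ.* ½ ℚ.* (1ℚ ℚ.+ p ℚ.* p) ℚ.- ½ ℚ.* ½ ℚ.* (1ℚ ℚ.+ q ℚ.* q) ∣
        ≡⟨ cong ∣_∣ (solve 2 (λ p q →
             con ½ :* con ½ :* (con 1ℚ :+ p :* p) :- con ½ :* con ½ :* (con 1ℚ :+ q :* q) :=
             con ½ :* ((con ½ :* (p :+ q)) :* (p :- q))) refl p q) ⟩
      ∣ ½ ℚ.* (m ℚ.* (p ℚ.- q)) ∣
        ≡⟨ trans (ℚ.∣p*q∣≡∣p∣*∣q∣ ½ (m ℚ.* (p ℚ.- q)))
             (cong (½ ℚ.*_) (ℚ.∣p*q∣≡∣p∣*∣q∣ m (p ℚ.- q))) ⟩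
      ½ ℚ.* (∣ m ∣ ℚ.* ∣ p ℚ.- q ∣)
        ≤⟨ ℚ.*-monoˡ-≤-nonNeg ½ (ℚ.*-monoʳ-≤-nonNeg ∣ p ℚ.- q ∣ {{nonNegative (ℚ.0≤∣p∣ (p ℚ.- q))}} ∣m∣≤1) ⟩
      ½ ℚ.* (1ℚ ℚ.* ∣ p ℚ.- q ∣)
        ≡⟨ cong (½ ℚ.*_) (ℚ.*-identityˡ ∣ p ℚ.- q ∣) ⟩
      ½ ℚ.* ∣ p ℚ.- q ∣ ∎
      where
      m = ½ ℚ.* (p ℚ.+ q)
      ∣m∣≤1 : ∣ m ∣ ℚ.≤ 1ℚ
      ∣m∣≤1 = subst (ℚ._≤ 1ℚ)
        (sym (ℚ.0≤p⇒∣p∣≡p (ℚ.*-monoˡ-≤-nonNeg ½ (ℚ.+-mono-≤ 0≤p 0≤q))))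
        (ℚ.*-monoˡ-≤-nonNeg ½ (ℚ.+-mono-≤ p≤1 q≤1))

    -- Each step halves the distance, which is at most the length of the unit interval at the start.
    close : ∀ m k → ∣ d (m ℕ.+ k) ℚ.- d m ∣ ℚ.≤ r m
    close zero    k = subst (ℚ._≤ 1ℚ)
      (sym (trans (cong ∣_∣ (ℚ.+-identityʳ (d k))) (ℚ.0≤p⇒∣p∣≡p (proj₁ (d∈[0,1] k)))))
      (proj₂ (d∈[0,1] k))
    close (suc m) k = ℚ.≤-trans
      (contraction (d (m ℕ.+ k)) (d m) (d∈[0,1] (m ℕ.+ k)) (d∈[0,1] m))
      (ℚ.*-monoˡ-≤-nonNeg ½ (close m k))

    -- The right side is `1 / (n + 1)`; for unnormalised fractions the comparison is a
    -- cross-multiplication.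
    r≤1/suc : ∀ n → toℚᵘ (r n) ℚᵘ.≤ ℚᵘ.mkℚᵘ (ℤ.+ 1) n
    r≤1/suc zero    = ℚᵘ.≤-refl
    r≤1/suc (suc n) = ℚᵘ.≤-trans (ℚᵘ.≤-reflexive (ℚ.toℚᵘ-homo-* ½ (r n)))
      (ℚᵘ.≤-trans (ℚᵘ.*-monoʳ-≤-nonNeg (toℚᵘ ½) (r≤1/suc n))
        (ℚᵘ.*≤* (ℤ.+≤+ (s≤s (halves n)))))
      where
      halves : ∀ n → suc (n ℕ.+ 0) ℕ.≤ n ℕ.+ suc (n ℕ.+ 0) ℕ.+ 0
      halves n rewrite ℕ.+-identityʳ n | ℕ.+-identityʳ (n ℕ.+ suc n) = ℕ.m≤n+m (suc n) n

    r-small : ∀ ε → 0ℚ ℚ.< ε → ∃[ N ] r N ℚ.≤ ε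
    -- Here `ε = (p + 1) / (q + 1)`, which is at least `1 / (q + 1)`, so `N = q` suffices.
    r-small (mkℚ (ℤ.+ suc p) q _) _ = q , ℚ.toℚᵘ-cancel-≤ (ℚᵘ.≤-trans (r≤1/suc q) (ℚᵘ.*≤* (ℤ.+≤+ (s≤s (ℕ.+-monoʳ-≤ q z≤n)))))
    r-small (mkℚ ℤ.+0 q _) (ℚ.*<* (ℤ.+<+ ()))
    r-small (mkℚ (ℤ.-[1+ p ]) q _) (ℚ.*<* ())

    d-cauchy : Cauchy d
    d-cauchy ε 0<ε = go (r-small (½ ℚ.* ε) (half-pos 0<ε))
      where
      go : ∃[ N ] r N ℚ.≤ ½ ℚ.* ε → ∃[ N ] (∀ m n → N ℕ.≤ m → N ℕ.≤ n → ∣ d m ℚ.- d n ∣ ℚ.≤ ε)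
      go (N , rN≤) = N , λ m n N≤m N≤n → begin
        ∣ d m ℚ.- d n ∣
          ≡⟨ cong ∣_∣ (solve 3 (λ a b c → a :- b := (a :- c) :+ :- (b :- c)) refl (d m) (d n) (d N)) ⟩
        ∣ (d m ℚ.- d N) ℚ.+ ℚ.- (d n ℚ.- d N) ∣
          ≤⟨ ℚ.∣p+q∣≤∣p∣+∣q∣ (d m ℚ.- d N) (ℚ.- (d n ℚ.- d N)) ⟩
        ∣ d m ℚ.- d N ∣ ℚ.+ ∣ ℚ.- (d n ℚ.- d N) ∣
          ≡⟨ cong (∣ d m ℚ.- d N ∣ ℚ.+_) (ℚ.∣-p∣≡∣p∣ (d n ℚ.- d N)) ⟩
        ∣ d m ℚ.- d N ∣ ℚ.+ ∣ d n ℚ.- d N ∣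
          ≤⟨ ℚ.+-mono-≤ (near m N≤m) (near n N≤n) ⟩
        ½ ℚ.* ε ℚ.+ ½ ℚ.* ε
          ≡⟨ half+half ε ⟩
        ε ∎
        where
        near : ∀ m → N ℕ.≤ m → ∣ d m ℚ.- d N ∣ ℚ.≤ ½ ℚ.* ε
        near m N≤m = ℚ.≤-trans
          (subst (λ m → ∣ d m ℚ.- d N ∣ ℚ.≤ r N) (ℕ.m+[n∸m]≡n N≤m) (close N (m ℕ.∸ N))) rN≤

    √3 : ℝ
    √3 = fromℚ (1ℚ ℚ.+ 1ℚ) - mkℝ d d-cauchy

    step≈0 : Zero (mkℝ (d ∘ suc) (λ ε 0<ε → let N , c = d-cauchy ε 0<ε in
               N , λ m n N≤m N≤n → c (suc m) (suc n) (ℕ.m≤n⇒m≤1+n N≤m) (ℕ.m≤n⇒m≤1+n N≤n))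
               - mkℝ d d-cauchy)
    step≈0 = mkZero λ ε 0<ε → let N , c = d-cauchy ε 0<ε in
      N , λ n N≤n → c (suc n) n (ℕ.m≤n⇒m≤1+n N≤n) N≤n

    3ℝ : ℝ
    3ℝ = fromℚ (1ℚ ℚ.+ 1ℚ ℚ.+ 1ℚ)

    -- With `√3 = 2 - d`, the difference `(2 - d)² - 3` is four times the increment
    -- `(1 + d²) / 4 - d` of the recursion, which is null by `step≈0`.
    √3²≈3 : Zero (√3 * √3 - 3ℝ)
    √3²≈3 = zero₁ (fromℚ (1ℚ ℚ.+ 1ℚ ℚ.+ 1ℚ ℚ.+ 1ℚ)) step≈0 λ n →
      solve 1 (λ d →
        let two = con 1ℚ :+ con 1ℚ
            e   = con ½ :* con ½ :* (con 1ℚ :+ d :* d) :- d in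
        (two :- d) :* (two :- d) :- (two :+ con 1ℚ) :=
        (two :+ con 1ℚ :+ con 1ℚ) :* e)
      refl (d n)

  -- Lexicographic order on the plane.

  infixl 6 _⊖_

  _⊖_ : ℂ → ℂ → ℂ
  (x , y) ⊖ (x′ , y′) = x - x′ , y - y′

  record Zeroℂ (p : ℂ) : Set where
    constructor _,_
    field
      re : Zero (proj₁ p)
      im : Zero (proj₂ p)

  -- The positive cone of the lexicographic order, in which points are compared through their
  -- difference.
  data Lex (p : ℂ) : Set where
    re>0 : Pos (proj₁ p) → Lex p
    im>0 : Zero (proj₁ p) → Pos (proj₂ p) → Lex p

  -- A relation, so that `r` may be a telescoped difference agreeing with the sum only termwise.
  record IsSum (p q r : ℂ) : Set where
    constructor _,_
    field
      re : ∀ n → seq (proj₁ r) n ≡ seq (proj₁ p) n ℚ.+ seq (proj₁ q) n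
      im : ∀ n → seq (proj₂ r) n ≡ seq (proj₂ p) n ℚ.+ seq (proj₂ q) n

  private variable
    n : ℕ
    p q r : ℂ

  zero-sum : ∀ {x y z} → Zero x → Zero y → (∀ n → seq z n ≡ seq x n ℚ.+ seq y n) → Zero z
  zero-sum {x} {y} x≈0 y≈0 z≗ = zero-cong {x = x + y} z≗ (zero-+ {x} {y} x≈0 y≈0)

  swap-sum : ∀ {a} b c → a ≡ b ℚ.+ c → a ≡ c ℚ.+ b
  swap-sum b c eq = trans eq (ℚ.+-comm b c)

  lex-+ : Lex p → Lex q → IsSum p q r → Lex r
  lex-+ (re>0 x>0)     (re>0 x′>0)      (x≗ , _)  = re>0 (pos-+ x>0 x′>0 x≗)
  lex-+ (re>0 x>0)     (im>0 x′≈0 _)    (x≗ , _)  = re>0 (pos-shift x>0 x′≈0 x≗)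
  lex-+ {x , _} {x′ , _} (im>0 x≈0 _) (re>0 x′>0) (x≗ , _) =
    re>0 (pos-shift x′>0 x≈0 λ n → swap-sum (seq x n) (seq x′ n) (x≗ n))
  lex-+ (im>0 x≈0 y>0) (im>0 x′≈0 y′>0) (x≗ , y≗) =
    im>0 (zero-sum x≈0 x′≈0 x≗) (pos-+ y>0 y′>0 y≗)

  lex-shift : Lex p → Zeroℂ q → IsSum p q r → Lex r
  lex-shift (re>0 x>0)     (x′≈0 , _)    (x≗ , _)  = re>0 (pos-shift x>0 x′≈0 x≗)
  lex-shift (im>0 x≈0 y>0) (x′≈0 , y′≈0) (x≗ , y≗) =
    im>0 (zero-sum x≈0 x′≈0 x≗) (pos-shift y>0 y′≈0 y≗)

  lex-cong : ∀ p q → Zeroℂ (q ⊖ p) → Lex p → Lex q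
  lex-cong p q e pos = lex-shift {p} {q ⊖ p} {q} pos e
    ( (λ n → shift (seq (proj₁ p) n) (seq (proj₁ q) n))
    , (λ n → shift (seq (proj₂ p) n) (seq (proj₂ q) n)))
    where
    shift : ∀ a b → b ≡ a ℚ.+ (b ℚ.- a)
    shift = solve 2 (λ a b → b := a :+ (b :- a)) refl

  zero-swap : ∀ p q → Zeroℂ (p ⊖ q) → Zeroℂ (q ⊖ p)
  zero-swap p q (e≈0 , e′≈0) =
    zero₁ (fromℚ (ℚ.- 1ℚ)) e≈0 (λ n → negate (seq (proj₁ p) n) (seq (proj₁ q) n)) ,
    zero₁ (fromℚ (ℚ.- 1ℚ)) e′≈0 (λ n → negate (seq (proj₂ p) n) (seq (proj₂ q) n))
    where
    negate : ∀ a b → b ℚ.- a ≡ (ℚ.- 1ℚ) ℚ.* (a ℚ.- b)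
    negate = solve 2 (λ a b → b :- a := con (ℚ.- 1ℚ) :* (a :- b)) refl

  zero-reverse : ∀ a b c d → Zeroℂ ((a ⊖ b) ⊖ (c ⊖ d)) → Zeroℂ ((d ⊖ c) ⊖ (b ⊖ a))
  zero-reverse a b c d (e≈0 , e′≈0) =
    zero-cong (λ n → reverse (seq (proj₁ a) n) (seq (proj₁ b) n) (seq (proj₁ c) n) (seq (proj₁ d) n)) e≈0 ,
    zero-cong (λ n → reverse (seq (proj₂ a) n) (seq (proj₂ b) n) (seq (proj₂ c) n) (seq (proj₂ d) n)) e′≈0
    where
    reverse : ∀ a b c d → (d ℚ.- c) ℚ.- (b ℚ.- a) ≡ (a ℚ.- b) ℚ.- (c ℚ.- d)
    reverse = solve 4 (λ a b c d → (d :- c) :- (b :- a) := (a :- b) :- (c :- d)) refl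

  -- Together with `lex-congʳ` this turns one relation between differences into both the upward and
  -- the downward transfer between orders.
  lex-congˡ : ∀ a b c d → Zeroℂ ((a ⊖ b) ⊖ (c ⊖ d)) → Lex (a ⊖ b) → Lex (c ⊖ d)
  lex-congˡ a b c d e = lex-cong (a ⊖ b) (c ⊖ d) (zero-swap (a ⊖ b) (c ⊖ d) e)

  lex-congʳ : ∀ a b c d → Zeroℂ ((a ⊖ b) ⊖ (c ⊖ d)) → Lex (b ⊖ a) → Lex (d ⊖ c)
  lex-congʳ a b c d e = lex-cong (b ⊖ a) (d ⊖ c) (zero-reverse a b c d e)

  lex-irrefl : Zeroℂ p → ¬ Lex p
  lex-irrefl (x≈0 , _)   (re>0 x>0)   = zero⇒¬pos x≈0 x>0
  lex-irrefl (_   , y≈0) (im>0 _ y>0) = zero⇒¬pos y≈0 y>0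

  ¬pos∧¬pos⇒zero : ∀ x y → ¬ Pos (x - y) → ¬ Pos (y - x) → Zero (x - y)
  ¬pos∧¬pos⇒zero x y ¬pos ¬neg = ¬pos∧¬neg⇒zero (x - y) ¬pos λ pos →
    ¬neg (pos-cong pos λ n →
      solve 2 (λ a b → b :- a := :- (a :- b)) refl (seq x n) (seq y n))

  lex-total : ∀ p q → ¬ Lex (p ⊖ q) → ¬ Lex (q ⊖ p) → Zeroℂ (p ⊖ q)
  lex-total (x , y) (x′ , y′) ¬p<q ¬q<p =
    x≈x′ , ¬pos∧¬pos⇒zero y y′ (λ pos → ¬p<q (im>0 x≈x′ pos)) (λ pos → ¬q<p (im>0 x′≈x pos))
    where
    x≈x′ : Zero (x - x′)
    x≈x′ = ¬pos∧¬pos⇒zero x x′ (¬p<q ∘ re>0) (¬q<p ∘ re>0)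
    x′≈x : Zero (x′ - x)
    x′≈x = ¬pos∧¬pos⇒zero x′ x (¬q<p ∘ re>0) (¬p<q ∘ re>0)

  -- Comparison of Cauchy reals is not decidable, so decisions enter as an argument and are supplied
  -- later under double negation.
  decidable⇒isStrictTotalOrder : {A : Set} {_≺_ : Rel A 0ℓ} →
    (∀ i → ¬ i ≺ i) → (∀ i j k → i ≺ j → j ≺ k → i ≺ k) →
    (∀ i j → ¬ i ≺ j → ¬ j ≺ i → i ≡ j) →
    (∀ i j → Dec (i ≺ j)) → IsStrictTotalOrder _≡_ _≺_
  decidable⇒isStrictTotalOrder {_≺_ = _≺_} irrefl ≺-trans connex _≺?_ = record
    { isStrictPartialOrder = record
      { isEquivalence = isEquivalence
      ; irrefl        = λ { refl → irrefl _ }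
      ; trans         = ≺-trans _ _ _
      ; <-resp-≈      = (λ { refl i≺j → i≺j }) , (λ { refl i≺j → i≺j })
      }
    ; compare = compare
    }
    where
    compare : Trichotomous _≡_ _≺_
    compare i j with i ≺? j | j ≺? i
    ... | yes i≺j | _       = tri< i≺j (λ { refl → irrefl i i≺j }) (λ j≺i → irrefl i (≺-trans i j i i≺j j≺i))
    ... | no  i⊀j | yes j≺i = tri> i⊀j (λ { refl → irrefl i j≺i }) j≺i
    ... | no  i⊀j | no  j⊀i = tri≈ i⊀j (connex i j i⊀j j⊀i) j⊀i

  module LexOrder (f : Fin n → ℂ) (f-injective : ∀ {i j} → Zeroℂ (f i ⊖ f j) → i ≡ j) where

    _≺_ : Rel (Fin n) 0ℓ
    i ≺ j = Lex (f j ⊖ f i)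

    ⊖-telescope : ∀ p q r → IsSum (q ⊖ p) (r ⊖ q) (r ⊖ p)
    ⊖-telescope (x , y) (x′ , y′) (x″ , y″) =
      (λ n → telescope (seq x n) (seq x′ n) (seq x″ n)) ,
      (λ n → telescope (seq y n) (seq y′ n) (seq y″ n))
      where
      telescope : ∀ a b c → c ℚ.- a ≡ (b ℚ.- a) ℚ.+ (c ℚ.- b)
      telescope = solve 3 (λ a b c → c :- a := (b :- a) :+ (c :- b)) refl

    ≺-trans : ∀ {i j k} → i ≺ j → j ≺ k → i ≺ k
    ≺-trans {i} {j} {k} i≺j j≺k = (lex-+ i≺j j≺k (⊖-telescope (f i) (f j) (f k)))

    ≺-irrefl : ∀ {i} → ¬ i ≺ i
    ≺-irrefl {i} i≺i = lex-irrefl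
      ( zero₀ (λ n → ℚ.+-inverseʳ (seq (proj₁ (f i)) n))
      , zero₀ (λ n → ℚ.+-inverseʳ (seq (proj₂ (f i)) n))) i≺i

    ≺-connex : ∀ {i j} → ¬ i ≺ j → ¬ j ≺ i → i ≡ j
    ≺-connex {i} {j} i⊀j j⊀i = f-injective (lex-total (f i) (f j) j⊀i i⊀j)

    ≺-isStrictTotalOrder : (∀ i j → Dec (i ≺ j)) → IsStrictTotalOrder _≡_ _≺_
    ≺-isStrictTotalOrder = decidable⇒isStrictTotalOrder
      (λ i → ≺-irrefl {i}) (λ i j k → ≺-trans {i} {j} {k}) (λ i j → ≺-connex {i} {j})

  -- Rotation by 60 degrees.

  module Rotation (σ : ℝ) (σ²≈3 : Zero (σ * σ - √3.3ℝ)) where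

    -- Multiplication by `ω = (1 + σ i) / 2`, a primitive sixth root of unity when `σ² = 3`.
    rot : ℂ → ℂ
    rot (x , y) = fromℚ ½ * x - fromℚ ½ * (σ * y) , fromℚ ½ * (σ * x) + fromℚ ½ * y

    -- rot is invertible since rot² - rot + 1 = 0.
    rot-zero⁻¹ : ∀ p q → Zeroℂ (rot p ⊖ rot q) → Zeroℂ (p ⊖ q)
    rot-zero⁻¹ (x , y) (x′ , y′) (e≈0 , e′≈0) =
      -- The first two coefficients come from the conjugate of `ω`; its product with `ω` is
      -- `(1 + σ²) / 4`, and the third term corrects the deviation of this from one.
      zero₃ (fromℚ ½) (fromℚ ½ * σ) (fromℚ (ℚ.- (½ ℚ.* ½)) * (x - x′)) e≈0 e′≈0 σ²≈3
        (λ n → solve 5 (λ σ x y x′ y′ →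
           x :- x′ := con ½ :* ((con ½ :* x :- con ½ :* (σ :* y)) :- (con ½ :* x′ :- con ½ :* (σ :* y′)))
                      :+ con ½ :* σ :* ((con ½ :* (σ :* x) :+ con ½ :* y) :- (con ½ :* (σ :* x′) :+ con ½ :* y′))
                      :+ con (ℚ.- (½ ℚ.* ½)) :* (x :- x′) :* (σ :* σ :- con (1ℚ ℚ.+ 1ℚ ℚ.+ 1ℚ)))
           refl (seq σ n) (seq x n) (seq y n) (seq x′ n) (seq y′ n)) ,
      zero₃ (- (fromℚ ½ * σ)) (fromℚ ½) (fromℚ (ℚ.- (½ ℚ.* ½)) * (y - y′)) e≈0 e′≈0 σ²≈3
        (λ n → solve 5 (λ σ x y x′ y′ →
           y :- y′ := :- (con ½ :* σ) :* ((con ½ :* x :- con ½ :* (σ :* y)) :- (con ½ :* x′ :- con ½ :* (σ :* y′)))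
                      :+ con ½ :* ((con ½ :* (σ :* x) :+ con ½ :* y) :- (con ½ :* (σ :* x′) :+ con ½ :* y′))
                      :+ con (ℚ.- (½ ℚ.* ½)) :* (y :- y′) :* (σ :* σ :- con (1ℚ ℚ.+ 1ℚ ℚ.+ 1ℚ)))
           refl (seq σ n) (seq x n) (seq y n) (seq x′ n) (seq y′ n))
    private
      reᵖ imᵖ : ∀ {k} → Polynomial k → Polynomial k → Polynomial k → Polynomial k
      reᵖ σ x y = con ½ :* x :- con ½ :* (σ :* y)
      imᵖ σ x y = con ½ :* (σ :* x) :+ con ½ :* y

      1ℝ -1ℝ : ℝ
      1ℝ  = fromℚ 1ℚ
      -1ℝ = fromℚ (ℚ.- 1ℚ)

      ¼ 3ℚ : ℚ
      ¼  = ½ ℚ.* ½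
      3ℚ = 1ℚ ℚ.+ 1ℚ ℚ.+ 1ℚ

      κᵖ : ∀ {k} → Polynomial k → Polynomial k
      κᵖ σ = σ :* σ :- con 3ℚ

    rot-difference : ∀ a b c d → Zeroℂ ((a ⊖ b) ⊖ (c ⊖ d)) →
                     Zeroℂ ((rot a ⊖ rot b) ⊖ (rot c ⊖ rot d))
    rot-difference (a , a′) (b , b′) (c , c′) (d , d′) (e≈0 , e′≈0) =
      zero₂ (fromℚ ½) (- (fromℚ ½ * σ)) e≈0 e′≈0 (λ n → solve 9 (λ σ a a′ b b′ c c′ d d′ →
        (reᵖ σ a a′ :- reᵖ σ b b′) :- (reᵖ σ c c′ :- reᵖ σ d d′) :=
        con ½ :* ((a :- b) :- (c :- d)) :+ :- (con ½ :* σ) :* ((a′ :- b′) :- (c′ :- d′)))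
        refl (seq σ n) (seq a n) (seq a′ n) (seq b n) (seq b′ n) (seq c n) (seq c′ n) (seq d n) (seq d′ n)) ,
      zero₂ (fromℚ ½ * σ) (fromℚ ½) e≈0 e′≈0 (λ n → solve 9 (λ σ a a′ b b′ c c′ d d′ →
        (imᵖ σ a a′ :- imᵖ σ b b′) :- (imᵖ σ c c′ :- imᵖ σ d d′) :=
        con ½ :* σ :* ((a :- b) :- (c :- d)) :+ con ½ :* ((a′ :- b′) :- (c′ :- d′)))
        refl (seq σ n) (seq a n) (seq a′ n) (seq b n) (seq b′ n) (seq c n) (seq c′ n) (seq d n) (seq d′ n))

    -- This is `ω³ + 1 = (ω + 1) (ω² - ω + 1)`, where the last factor equals `- (σ² - 3) / 4`.
    rot³≈-1 : ∀ p → Zero (proj₁ (rot (rot (rot p))) + proj₁ p) × Zero (proj₂ (rot (rot (rot p))) + proj₂ p)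
    rot³≈-1 (x , y) =
      zero₁ (fromℚ (ℚ.- ¼) * (proj₁ (rot (x , y)) + x)) σ²≈3 (λ n → solve 3 (λ σ x y →
        reᵖ σ (reᵖ σ (reᵖ σ x y) (imᵖ σ x y)) (imᵖ σ (reᵖ σ x y) (imᵖ σ x y)) :+ x :=
        con (ℚ.- ¼) :* (reᵖ σ x y :+ x) :* κᵖ σ)
        refl (seq σ n) (seq x n) (seq y n)) ,
      zero₁ (fromℚ (ℚ.- ¼) * (proj₂ (rot (x , y)) + y)) σ²≈3 (λ n → solve 3 (λ σ x y →
        imᵖ σ (reᵖ σ (reᵖ σ x y) (imᵖ σ x y)) (imᵖ σ (reᵖ σ x y) (imᵖ σ x y)) :+ y :=
        con (ℚ.- ¼) :* (imᵖ σ x y :+ y) :* κᵖ σ)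
        refl (seq σ n) (seq x n) (seq y n))

    IsTurn : ℂ → ℂ → ℂ → Set
    IsTurn z y x = Zeroℂ ((y ⊖ z) ⊖ rot (x ⊖ z))

    -- By linearity, the displacement of `y` from `z` becomes that of `x` from `z` after one more
    -- rotation. Applying `rot` again carries this to the later orders.
    turn₀₁ : ∀ z y x → IsTurn z y x → Zeroℂ ((y ⊖ z) ⊖ (rot x ⊖ rot z))
    turn₀₁ (z , z′) (y , y′) (x , x′) (e≈0 , e′≈0) =
      zero-cong (λ n → solve 7 (λ σ z z′ y y′ x x′ →
        (y :- z) :- (reᵖ σ x x′ :- reᵖ σ z z′) := (y :- z) :- reᵖ σ (x :- z) (x′ :- z′))
        refl (seq σ n) (seq z n) (seq z′ n) (seq y n) (seq y′ n) (seq x n) (seq x′ n)) e≈0 ,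
      zero-cong (λ n → solve 7 (λ σ z z′ y y′ x x′ →
        (y′ :- z′) :- (imᵖ σ x x′ :- imᵖ σ z z′) := (y′ :- z′) :- imᵖ σ (x :- z) (x′ :- z′))
        refl (seq σ n) (seq z n) (seq z′ n) (seq y n) (seq y′ n) (seq x n) (seq x′ n)) e′≈0

    turn₁₂ : ∀ z y x → IsTurn z y x → Zeroℂ ((rot y ⊖ rot z) ⊖ (rot (rot x) ⊖ rot (rot z)))
    turn₁₂ z y x t = rot-difference y z (rot x) (rot z) (turn₀₁ z y x t)

    turn₂₀ : ∀ z y x → IsTurn z y x → Zeroℂ ((rot (rot y) ⊖ rot (rot z)) ⊖ (z ⊖ x))
    turn₂₀ z y x t
      -- In the third rotation of the relation, the images of `x` and `z` under `rot³` are replaced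
      -- by `- x` and `- z`, which reverses the displacement.
      = zero₃ 1ℝ 1ℝ -1ℝ (Zeroℂ.re e) (proj₁ (rot³≈-1 x)) (proj₁ (rot³≈-1 z)) (λ n →
          combine (seq (proj₁ (rot (rot y))) n) (seq (proj₁ (rot (rot z))) n)
                  (seq (proj₁ (rot (rot (rot x)))) n) (seq (proj₁ (rot (rot (rot z)))) n)
                  (seq (proj₁ x) n) (seq (proj₁ z) n)) ,
        zero₃ 1ℝ 1ℝ -1ℝ (Zeroℂ.im e) (proj₂ (rot³≈-1 x)) (proj₂ (rot³≈-1 z)) (λ n →
          combine (seq (proj₂ (rot (rot y))) n) (seq (proj₂ (rot (rot z))) n)
                  (seq (proj₂ (rot (rot (rot x)))) n) (seq (proj₂ (rot (rot (rot z)))) n)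
                  (seq (proj₂ x) n) (seq (proj₂ z) n))
      where
      e = rot-difference (rot y) (rot z) (rot (rot x)) (rot (rot z)) (turn₁₂ z y x t)
      combine : ∀ a b c d x z → (a ℚ.- b) ℚ.- (z ℚ.- x) ≡
        1ℚ ℚ.* ((a ℚ.- b) ℚ.- (c ℚ.- d)) ℚ.+ 1ℚ ℚ.* (c ℚ.+ x) ℚ.+ (ℚ.- 1ℚ) ℚ.* (d ℚ.+ z)
      combine = solve 6 (λ a b c d x z → (a :- b) :- (z :- x) :=
        con 1ℚ :* ((a :- b) :- (c :- d)) :+ con 1ℚ :* (c :+ x) :+ con (ℚ.- 1ℚ) :* (d :+ z)) refl

    turn-injective : ∀ z y y′ x → IsTurn z y x → IsTurn z y′ x → Zeroℂ (y ⊖ y′)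
    turn-injective z y y′ x (e≈0 , e′≈0) (f≈0 , f′≈0) =
      zero₂ 1ℝ -1ℝ e≈0 f≈0 (λ n → cancel (seq (proj₁ z) n) (seq (proj₁ y) n) (seq (proj₁ y′) n)
        (seq (proj₁ (rot (x ⊖ z))) n)) ,
      zero₂ 1ℝ -1ℝ e′≈0 f′≈0 (λ n → cancel (seq (proj₂ z) n) (seq (proj₂ y) n) (seq (proj₂ y′) n)
        (seq (proj₂ (rot (x ⊖ z))) n))
      where
      cancel : ∀ z y y′ r → y ℚ.- y′ ≡
        1ℚ ℚ.* ((y ℚ.- z) ℚ.- r) ℚ.+ (ℚ.- 1ℚ) ℚ.* ((y′ ℚ.- z) ℚ.- r)
      cancel = solve 4 (λ z y y′ r → y :- y′ :=
        con 1ℚ :* ((y :- z) :- r) :+ con (ℚ.- 1ℚ) :* ((y′ :- z) :- r)) refl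

    turn-functional : ∀ z y x x′ → IsTurn z y x → IsTurn z y x′ → Zeroℂ (x ⊖ x′)
    turn-functional z y x x′ t t′ = rot-zero⁻¹ x x′
      ( zero₂ -1ℝ 1ℝ (Zeroℂ.re e) (Zeroℂ.re f) (λ n → cancel (seq (proj₁ z) n) (seq (proj₁ y) n)
          (seq (proj₁ (rot z)) n) (seq (proj₁ (rot x)) n) (seq (proj₁ (rot x′)) n))
      , zero₂ -1ℝ 1ℝ (Zeroℂ.im e) (Zeroℂ.im f) (λ n → cancel (seq (proj₂ z) n) (seq (proj₂ y) n)
          (seq (proj₂ (rot z)) n) (seq (proj₂ (rot x)) n) (seq (proj₂ (rot x′)) n)))
      where
      e = turn₀₁ z y x t
      f = turn₀₁ z y x′ t′
      cancel : ∀ z y rz rx rx′ → rx ℚ.- rx′ ≡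
        (ℚ.- 1ℚ) ℚ.* ((y ℚ.- z) ℚ.- (rx ℚ.- rz)) ℚ.+ 1ℚ ℚ.* ((y ℚ.- z) ℚ.- (rx′ ℚ.- rz))
      cancel = solve 5 (λ z y rz rx rx′ → rx :- rx′ :=
        con (ℚ.- 1ℚ) :* ((y :- z) :- (rx :- rz)) :+ con 1ℚ :* ((y :- z) :- (rx′ :- rz))) refl

    -- For `e = (y - z) - ω (x - z)`, the defect of the new turn is
    -- `(ω - 1) e + (ω² - ω + 1) (x - z)`.
    turn-cyclic : ∀ z y x → IsTurn z y x → IsTurn y x z
    turn-cyclic (z , z′) (y , y′) (x , x′) (e≈0 , e′≈0) =
      zero₃ (fromℚ (ℚ.- ½)) (- (fromℚ ½ * σ)) (fromℚ (ℚ.- ¼) * (x - z)) e≈0 e′≈0 σ²≈3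
        (λ n → solve 7 (λ σ z z′ y y′ x x′ →
          (x :- y) :- reᵖ σ (z :- y) (z′ :- y′) :=
          con (ℚ.- ½) :* ((y :- z) :- reᵖ σ (x :- z) (x′ :- z′))
          :+ :- (con ½ :* σ) :* ((y′ :- z′) :- imᵖ σ (x :- z) (x′ :- z′))
          :+ con (ℚ.- ¼) :* (x :- z) :* κᵖ σ)
          refl (seq σ n) (seq z n) (seq z′ n) (seq y n) (seq y′ n) (seq x n) (seq x′ n)) ,
      zero₃ (fromℚ ½ * σ) (fromℚ (ℚ.- ½)) (fromℚ (ℚ.- ¼) * (x′ - z′)) e≈0 e′≈0 σ²≈3
        (λ n → solve 7 (λ σ z z′ y y′ x x′ →
          (x′ :- y′) :- imᵖ σ (z :- y) (z′ :- y′) :=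
          con ½ :* σ :* ((y :- z) :- reᵖ σ (x :- z) (x′ :- z′))
          :+ con (ℚ.- ½) :* ((y′ :- z′) :- imᵖ σ (x :- z) (x′ :- z′))
          :+ con (ℚ.- ¼) :* (x′ :- z′) :* κᵖ σ)
          refl (seq σ n) (seq z n) (seq z′ n) (seq y n) (seq y′ n) (seq x n) (seq x′ n))

    -- Equilateral triangles as turns.

    zeroℂ-norm : ∀ p → Zero (proj₁ p * proj₁ p + proj₂ p * proj₂ p) → Zeroℂ p
    zeroℂ-norm (x , y) norm≈0 = zero-squares x y norm≈0 ,
      zero-squares y x (zero-cong (λ n → ℚ.+-comm (seq y n ℚ.* seq y n) (seq x n ℚ.* seq x n)) norm≈0)

    -- For v = b - a and w = c - a the numbers F = X - σ (v × w) and
    -- G = X + σ (v × w), where X = |v|² + |w|² - v · w, equal |v - rot w|² and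
    -- |w - rot v|²; their product vanishes on equilateral triangles.
    module _ (v w : ℂ) where
      private
        v₁ = proj₁ v ; v₂ = proj₂ v ; w₁ = proj₁ w ; w₂ = proj₂ w
        P = v₁ * v₁ + v₂ * v₂
        Q = w₁ * w₁ + w₂ * w₂
        K = v₁ * w₁ + v₂ * w₂
        X = P + Q - K
        C = σ * (v₂ * w₁ - v₁ * w₂)
        α = P - (K + K)
        β = Q - (K + K)

      -- Lagrange's identity gives `(v × w)² = P Q - K²`, so the product is `X² - 3 (P Q - K²)` up
      -- to a multiple of `σ² - 3`; this equals `α² - α β + β²`.
      norms-product : Zero α → Zero β → Zero ((X - C) * (X + C))
      norms-product α≈0 β≈0 = zero₃ (α - β) β (K * K - P * Q) α≈0 β≈0 σ²≈3 λ n →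
        solve 5 (λ σ v₁ v₂ w₁ w₂ →
          let P = v₁ :* v₁ :+ v₂ :* v₂
              Q = w₁ :* w₁ :+ w₂ :* w₂
              K = v₁ :* w₁ :+ v₂ :* w₂
              X = P :+ Q :- K
              C = σ :* (v₂ :* w₁ :- v₁ :* w₂)
              α = P :- (K :+ K)
              β = Q :- (K :+ K)
          in (X :- C) :* (X :+ C) := (α :- β) :* α :+ β :* β :+ (K :* K :- P :* Q) :* κᵖ σ)
        refl (seq σ n) (seq v₁ n) (seq v₂ n) (seq w₁ n) (seq w₂ n)

      norm₁ : Zero (X - C) → Zeroℂ (v ⊖ rot w)
      -- The second term is the deviation of `rot` from an isometry: `|rot w|² = Q (1 + σ²) / 4`.
      norm₁ F≈0 = zeroℂ-norm (v ⊖ rot w) (zero₂ 1ℝ (fromℚ ¼ * Q) F≈0 σ²≈3 λ n →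
        solve 5 (λ σ v₁ v₂ w₁ w₂ →
          let P = v₁ :* v₁ :+ v₂ :* v₂
              Q = w₁ :* w₁ :+ w₂ :* w₂
              K = v₁ :* w₁ :+ v₂ :* w₂
              C = σ :* (v₂ :* w₁ :- v₁ :* w₂)
              e = v₁ :- reᵖ σ w₁ w₂
              f = v₂ :- imᵖ σ w₁ w₂
          in e :* e :+ f :* f := con 1ℚ :* (P :+ Q :- K :- C) :+ con ¼ :* Q :* κᵖ σ)
        refl (seq σ n) (seq v₁ n) (seq v₂ n) (seq w₁ n) (seq w₂ n))

      norm₂ : Zero (X + C) → Zeroℂ (w ⊖ rot v)
      norm₂ G≈0 = zeroℂ-norm (w ⊖ rot v) (zero₂ 1ℝ (fromℚ ¼ * P) G≈0 σ²≈3 λ n →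
        solve 5 (λ σ v₁ v₂ w₁ w₂ →
          let P = v₁ :* v₁ :+ v₂ :* v₂
              Q = w₁ :* w₁ :+ w₂ :* w₂
              K = v₁ :* w₁ :+ v₂ :* w₂
              C = σ :* (v₂ :* w₁ :- v₁ :* w₂)
              e = w₁ :- reᵖ σ v₁ v₂
              f = w₂ :- imᵖ σ v₁ v₂
          in e :* e :+ f :* f := con 1ℚ :* (P :+ Q :- K :+ C) :+ con ¼ :* P :* κᵖ σ)
        refl (seq σ n) (seq v₁ n) (seq v₂ n) (seq w₁ n) (seq w₂ n))

      turn-or-turn : Zero α → Zero β → ¬ Zeroℂ (v ⊖ rot w) → ¬ ¬ Zeroℂ (w ⊖ rot v)
      turn-or-turn α≈0 β≈0 ¬t ¬t′ = zero-product (X - C) (X + C) (norms-product α≈0 β≈0)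
        (¬t ∘ norm₁) (¬t′ ∘ norm₂)

    ≈⇒zero : ∀ {x y} → x ≈ y → Zero (x - y)
    ≈⇒zero x≈y = mkZero (converges x≈y)

    -- By the law of cosines, `α = |b - c|² - |a - c|²` and `β = |b - c|² - |a - b|²`, both null
    -- when the three distances agree.
    equilateral⇒turn : ∀ a b c → Equilateral a b c → ¬ IsTurn a b c → ¬ ¬ IsTurn a c b
    equilateral⇒turn (a , a′) (b , b′) (c , c′) (_ , d , (_ , ab) , (_ , bc) , (_ , ac)) =
      turn-or-turn ((b , b′) ⊖ (a , a′)) ((c , c′) ⊖ (a , a′))
        (zero₂ 1ℝ -1ℝ (≈⇒zero ac) (≈⇒zero bc) (λ n → solve 7 (λ a a′ b b′ c c′ d →
          let ac = (a :- c) :* (a :- c) :+ (a′ :- c′) :* (a′ :- c′)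
              bc = (b :- c) :* (b :- c) :+ (b′ :- c′) :* (b′ :- c′)
              K = (b :- a) :* (c :- a) :+ (b′ :- a′) :* (c′ :- a′)
              P = (b :- a) :* (b :- a) :+ (b′ :- a′) :* (b′ :- a′)
          in P :- (K :+ K) := con 1ℚ :* (d :* d :- ac) :+ con (ℚ.- 1ℚ) :* (d :* d :- bc))
          refl (seq a n) (seq a′ n) (seq b n) (seq b′ n) (seq c n) (seq c′ n) (seq d n)))
        (zero₂ 1ℝ -1ℝ (≈⇒zero ab) (≈⇒zero bc) (λ n → solve 7 (λ a a′ b b′ c c′ d →
          let ab = (a :- b) :* (a :- b) :+ (a′ :- b′) :* (a′ :- b′)
              bc = (b :- c) :* (b :- c) :+ (b′ :- c′) :* (b′ :- c′)
              K = (b :- a) :* (c :- a) :+ (b′ :- a′) :* (c′ :- a′)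
              Q = (c :- a) :* (c :- a) :+ (c′ :- a′) :* (c′ :- a′)
          in Q :- (K :+ K) := con 1ℚ :* (d :* d :- ab) :+ con (ℚ.- 1ℚ) :* (d :* d :- bc))
          refl (seq a n) (seq a′ n) (seq b n) (seq b′ n) (seq c n) (seq c′ n) (seq d n)))

    -- The rotation system of a point set.

    module Triangles {m} (P : Fin (suc m) → ℂ)
                     (P-injective : ∀ {i j} → Zeroℂ (P i ⊖ P j) → i ≡ j) where

      private
        P₁-injective : ∀ {i j} → Zeroℂ (rot (P i) ⊖ rot (P j)) → i ≡ j
        P₁-injective {i} {j} e = P-injective {i} {j} (rot-zero⁻¹ (P i) (P j) e)

        P₂-injective : ∀ {i j} → Zeroℂ (rot (rot (P i)) ⊖ rot (rot (P j))) → i ≡ j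
        P₂-injective {i} {j} e = P₁-injective {i} {j} (rot-zero⁻¹ (rot (P i)) (rot (P j)) e)

        module L₀ = LexOrder P  (λ {i} {j} → P-injective {i} {j})
        module L₁ = LexOrder (λ i → rot (P i)) (λ {i} {j} → P₁-injective {i} {j})
        module L₂ = LexOrder (λ i → rot (rot (P i))) (λ {i} {j} → P₂-injective {i} {j})

        -- Distinctness excludes the degenerate turn at a single point; it is listed cyclically, so
        -- that `cyclic` only rotates it.
        Turn : Triple (suc m) → Set
        Turn (z , y , x) = (z ≢ y × y ≢ x × x ≢ z) × IsTurn (P z) (P y) (P x)

        functional : ∀ z y x x′ → Turn (z , y , x) → Turn (z , y , x′) → x ≡ x′
        functional z y x x′ (_ , t) (_ , t′) =
          P-injective {x} {x′} (turn-functional (P z) (P y) (P x) (P x′) t t′)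

        injective′ : ∀ z y y′ x → Turn (z , y , x) → Turn (z , y′ , x) → y ≡ y′
        injective′ z y y′ x (_ , t) (_ , t′) =
          P-injective {y} {y′} (turn-injective (P z) (P y) (P y′) (P x) t t′)

        cyclic : ∀ z y x → Turn (z , y , x) → Turn (y , x , z)
        cyclic z y x ((z≢y , y≢x , x≢z) , t) = (y≢x , x≢z , z≢y) , turn-cyclic (P z) (P y) (P x) t

        up₀₁ : ∀ z y x → Turn (z , y , x) → z L₀.≺ y → z L₁.≺ x
        up₀₁ z y x (_ , t) = lex-congˡ (P y) (P z) (rot (P x)) (rot (P z)) (turn₀₁ (P z) (P y) (P x) t)

        down₀₁ : ∀ z y x → Turn (z , y , x) → y L₀.≺ z → x L₁.≺ z
        down₀₁ z y x (_ , t) = lex-congʳ (P y) (P z) (rot (P x)) (rot (P z)) (turn₀₁ (P z) (P y) (P x) t)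

        up₁₂ : ∀ z y x → Turn (z , y , x) → z L₁.≺ y → z L₂.≺ x
        up₁₂ z y x (_ , t) = lex-congˡ (rot (P y)) (rot (P z)) (rot (rot (P x))) (rot (rot (P z))) (turn₁₂ (P z) (P y) (P x) t)

        down₁₂ : ∀ z y x → Turn (z , y , x) → y L₁.≺ z → x L₂.≺ z
        down₁₂ z y x (_ , t) = lex-congʳ (rot (P y)) (rot (P z)) (rot (rot (P x))) (rot (rot (P z))) (turn₁₂ (P z) (P y) (P x) t)

        up₂₀ : ∀ z y x → Turn (z , y , x) → z L₂.≺ y → x L₀.≺ z
        up₂₀ z y x (_ , t) = lex-congˡ (rot (rot (P y))) (rot (rot (P z))) (P z) (P x) (turn₂₀ (P z) (P y) (P x) t)

        down₂₀ : ∀ z y x → Turn (z , y , x) → y L₂.≺ z → z L₀.≺ x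
        down₂₀ z y x (_ , t) = lex-congʳ (rot (rot (P y))) (rot (rot (P z))) (P z) (P x) (turn₂₀ (P z) (P y) (P x) t)

        system : (∀ i j → Dec (i L₀.≺ j)) → (∀ i j → Dec (i L₁.≺ j)) → (∀ i j → Dec (i L₂.≺ j)) →
                 (∀ t → Dec (Turn t)) → RotationSystem m
        system ≺₀? ≺₁? ≺₂? turn? = record
          { _≺₀_ = L₀._≺_
          ; _≺₁_ = L₁._≺_
          ; _≺₂_ = L₂._≺_
          ; order₀ = L₀.≺-isStrictTotalOrder ≺₀?
          ; order₁ = L₁.≺-isStrictTotalOrder ≺₁?
          ; order₂ = L₂.≺-isStrictTotalOrder ≺₂?
          ; Turn = Turn
          ; Turn? = turn?
          ; functional = λ {z} {y} {x} {x′} → functional z y x x′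
          ; injective = λ {z} {y} {y′} {x} → injective′ z y y′ x
          ; irreflexive = λ ((z≢y , _) , _) → z≢y
          ; cyclic = λ {z} {y} {x} → cyclic z y x
          ; up₀₁   = λ {z} {y} {x} → up₀₁ z y x
          ; down₀₁ = λ {z} {y} {x} → down₀₁ z y x
          ; up₁₂   = λ {z} {y} {x} → up₁₂ z y x
          ; down₁₂ = λ {z} {y} {x} → down₁₂ z y x
          ; up₂₀   = λ {z} {y} {x} → up₂₀ z y x
          ; down₂₀ = λ {z} {y} {x} → down₂₀ z y x
          }

        ¬¬-dec² : {R : Fin (suc m) → Fin (suc m) → Set} → ¬ ¬ (∀ i j → Dec (R i j))
        ¬¬-dec² = ¬¬-all λ i → ¬¬-all λ j → ¬¬-excluded-middle

        turn-or-turn′ : ∀ {i j k} → (∀ t → Dec (Turn t)) → i Fin.< j × j Fin.< k × Equilateral (P i) (P j) (P k) →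
                        Turn (i , j , k) ⊎ Turn (i , k , j)
        turn-or-turn′ {i} {j} {k} turn? (i<j , j<k , equilateral) =
          or-by-cases (turn? (i , j , k)) (turn? (i , k , j)) λ ¬t ¬t′ →
            equilateral⇒turn (P i) (P j) (P k) equilateral
              (λ t → ¬t ((i≢j , j≢k , ≢-sym i≢k) , t))
              (λ t → ¬t′ ((i≢k , ≢-sym j≢k , ≢-sym i≢j) , t))
          where
          i≢j = Fin.<⇒≢ i<j
          j≢k = Fin.<⇒≢ j<k
          i≢k = Fin.<⇒≢ (Fin.<-trans i<j j<k)

      length≤ : ∀ {ts} → Unique ts →
        (∀ i j k → (i , j , k) ∈ ts → i Fin.< j × j Fin.< k × Equilateral (P i) (P j) (P k)) →
        length ts ℕ.≤ ((4 ℕ.* suc m ℕ.∸ 1) ℕ.* m) ℕ./ 18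
      -- The bound is a decidable inequality, hence stable, so the finitely many decisions about
      -- orders and turns may be assumed.
      length≤ {ts} unique triangles = decidable-stable (length ts ℕ.≤? _) λ ¬bound →
        ¬¬-dec² {L₀._≺_} λ ≺₀? → ¬¬-dec² {L₁._≺_} λ ≺₁? → ¬¬-dec² {L₂._≺_} λ ≺₂? →
        (¬¬-all λ z → ¬¬-all λ y → ¬¬-all λ x → ¬¬-excluded-middle {A = Turn (z , y , x)}) λ turn →
        let turn? : ∀ t → Dec (Turn t)
            turn? (z , y , x) = turn z y x
        in ¬bound (Counting.length≤ (system ≺₀? ≺₁? ≺₂? turn?) unique λ i j k t∈ts →
          let i<j , j<k , equilateral = triangles i j k t∈ts in
          (i<j , j<k) , turn-or-turn′ {i} {j} {k} turn? (i<j , j<k , equilateral))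

-- The bound for the maximum.

open import Defs using (IsMaxTriangleCount; point; injective; mk≈)
open import Data.Nat using (ℕ; suc; NonZero; _*_; _∸_; _≤_; _/_)

theorem1 : ∀ (n : ℕ) .{{_ : NonZero n}} (m : ℕ) → IsMaxTriangleCount n m →
    m ≤ ((4 * n ∸ 1) * (n ∸ 1)) / 18
-- The maximum is attained at some `V`, and `refl` identifies `m` with the length of its list of
-- triangles.
theorem1 (suc n) m ((V , ts , unique , triangles , refl) , _) =
  Plane.Rotation.Triangles.length≤ Plane.√3.√3 Plane.√3.√3²≈3 (point V)
    (λ e → injective V (mk≈ (Plane.Zero.vanishes (Plane.Zeroℂ.re e)) ,
                        mk≈ (Plane.Zero.vanishes (Plane.Zeroℂ.im e))))
    unique (λ i j k → Equivalence.to (triangles (i , j , k)))
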